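{- $\alpha(W^{\Box 4}_5) \le 343$.
   Context: All graphs are finite and simple. $W_{5}$ denotes the $5$-wheel, the join of the cycle $C_{5}$ with a single vertex $K_1$ (so $W_5$ has $6$ vertices). The Cartesian product $G \Box H$ has vertex set $V(G)\times V(H)$, with $(u,x)$ adjacent to $(v,y)$ if and only if either $u=v$ and $xy\in E(H)$, or $x=y$ and $uv\in E(G)$. Set $G^{\Box 1}=G$ and $G^{\Box k}=G^{\Box (k-1)}\Box G$ for $k\ge 2$. $\alpha(G)$ is the independence number of $G$. -}

module Defs where

open import Data.Empty using (⊥)
open import Data.Fin.Base using (Fin; toℕ)
open import Data.Fin.Properties using (+↔⊎; *↔×; 1↔⊤; all?; inj⇒≟)
open import Data.Fin.Subset using (Subset; _∈_; ∣_∣; inside; outside)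
  renaming (⊥ to ∅)
open import Data.Fin.Subset.Properties using (_∈?_; ∉⊥)
open import Data.List.Base as List using (List; []; _∷_; _++_; filter)
open import Data.List.Extrema.Nat using (argmax; argmax-all; f[xs]≤f[argmax])
open import Data.List.Membership.Propositional using () renaming (_∈_ to _∈ˡ_)
open import Data.List.Membership.Propositional.Properties
  using (∈-map⁺; ∈-++⁺ˡ; ∈-++⁺ʳ; ∈-filter⁺)
import Data.List.Relation.Unary.All as All
open import Data.List.Relation.Unary.All.Properties using (all-filter)
open import Data.List.Relation.Unary.Any using (here)
open import Data.Nat.Base using (ℕ; zero; suc; _+_; _*_; _≤_; _%_; NonZero)
import Data.Nat.Properties as ℕ
open import Data.Product.Base using (_×_; _,_; ∃)
open import Data.Product.Function.NonDependent.Propositional using (_×-↔_)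
open import Data.Sum.Base as Sum using (_⊎_; inj₁; inj₂)
open import Data.Sum.Function.Propositional using (_⊎-↔_)
open import Data.Unit.Base using (⊤; tt)
open import Data.Vec.Base using ([]; _∷_)
open import Function.Base using (id)
open import Function.Bundles using (_↔_; Inverse)
open import Function.Construct.Composition using (_↔-∘_)
open import Function.Construct.Identity using (↔-id)
open import Function.Construct.Symmetry using (↔-sym)
open import Function.Properties.Inverse using (↔⇒↣)
open import Relation.Binary.Definitions
  using (Decidable; DecidableEquality; Irreflexive; Symmetric)
open import Relation.Binary.PropositionalEquality
  using (_≡_; refl; sym)
open import Relation.Nullary using (¬_; yes; no)
open import Relation.Nullary.Decidable
  using (_×-dec_; _⊎-dec_; _→-dec_; ¬?; toWitness)
import Relation.Unary as Unary

-- A finite simple graph.  Adjacency is decidable so that α can be defined as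
-- a maximum over an explicit list of vertex sets.

record Graph : Set₁ where
  infix 4 _~_ _~?_
  field
    Vertex : Set
    order  : ℕ
    enum   : Fin order ↔ Vertex
    _~_    : Vertex → Vertex → Set
    _~?_   : Decidable _~_
    ~-sym  : Symmetric _~_
    ~-irr  : Irreflexive _≡_ _~_

  vertex : Fin order → Vertex
  vertex = Inverse.to enum

  _≟ᵛ_ : DecidableEquality Vertex
  _≟ᵛ_ = inj⇒≟ (↔⇒↣ (↔-sym enum))

open Graph using (Vertex; order)

C₅ : Graph
C₅ = record
  { Vertex = Fin 5
  ; order  = 5
  ; enum   = ↔-id _
  ; _~_    = _~_
  ; _~?_   = _~?_
  ; ~-sym  = Sum.swap
  ; ~-irr  = λ { {i} refl → toWitness {a? = all? (λ k → ¬? (k ~? k))} _ i }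
  }
  where
  _~_ : Fin 5 → Fin 5 → Set
  i ~ j = (toℕ j ≡ suc (toℕ i) % 5) ⊎ (toℕ i ≡ suc (toℕ j) % 5)

  _~?_ : Decidable _~_
  i ~? j = (toℕ j ℕ.≟ suc (toℕ i) % 5) ⊎-dec (toℕ i ℕ.≟ suc (toℕ j) % 5)

K₁ : Graph
K₁ = record
  { Vertex = ⊤
  ; order  = 1
  ; enum   = 1↔⊤
  ; _~_    = λ _ _ → ⊥
  ; _~?_   = λ _ _ → no id
  ; ~-sym  = id
  ; ~-irr  = λ _ → id
  }

infixr 5 _join_

_join_ : Graph → Graph → Graph
G join H = record
  { Vertex = Vertex G ⊎ Vertex H
  ; order  = order G + order H
  ; enum   = (G.enum ⊎-↔ H.enum) ↔-∘ +↔⊎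
  ; _~_    = _~_
  ; _~?_   = _~?_
  ; ~-sym  = λ {p} {q} → ~-sym p q
  ; ~-irr  = λ { {p} refl → ~-irr p }
  }
  where
  module G = Graph G
  module H = Graph H

  _~_ : Vertex G ⊎ Vertex H → Vertex G ⊎ Vertex H → Set
  inj₁ u ~ inj₁ v = u G.~ v
  inj₂ x ~ inj₂ y = x H.~ y
  inj₁ _ ~ inj₂ _ = ⊤
  inj₂ _ ~ inj₁ _ = ⊤

  _~?_ : Decidable _~_
  inj₁ u ~? inj₁ v = u G.~? v
  inj₂ x ~? inj₂ y = x H.~? y
  inj₁ _ ~? inj₂ _ = yes tt
  inj₂ _ ~? inj₁ _ = yes tt

  ~-sym : ∀ p q → p ~ q → q ~ p
  ~-sym (inj₁ _) (inj₁ _) = G.~-sym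
  ~-sym (inj₂ _) (inj₂ _) = H.~-sym
  ~-sym (inj₁ _) (inj₂ _) = id
  ~-sym (inj₂ _) (inj₁ _) = id

  ~-irr : ∀ p → ¬ (p ~ p)
  ~-irr (inj₁ _) = G.~-irr refl
  ~-irr (inj₂ _) = H.~-irr refl

W₅ : Graph
W₅ = C₅ join K₁

infixl 7 _□_

_□_ : Graph → Graph → Graph
G □ H = record
  { Vertex = Vertex G × Vertex H
  ; order  = order G * order H
  ; enum   = (G.enum ×-↔ H.enum) ↔-∘ *↔×
  ; _~_    = _~_
  ; _~?_   = _~?_
  ; ~-sym  = λ where
      (inj₁ (u≡v , xy)) → inj₁ (sym u≡v , H.~-sym xy)
      (inj₂ (x≡y , uv)) → inj₂ (sym x≡y , G.~-sym uv)
  ; ~-irr  = λ where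
      refl (inj₁ (_ , xx)) → H.~-irr refl xx
      refl (inj₂ (_ , uu)) → G.~-irr refl uu
  }
  where
  module G = Graph G
  module H = Graph H

  _~_ : Vertex G × Vertex H → Vertex G × Vertex H → Set
  (u , x) ~ (v , y) = (u ≡ v × x H.~ y) ⊎ (x ≡ y × u G.~ v)

  _~?_ : Decidable _~_
  (u , x) ~? (v , y) = ((u G.≟ᵛ v) ×-dec (x H.~? y)) ⊎-dec ((x H.≟ᵛ y) ×-dec (u G.~? v))

infixl 8 _^□_

_^□_ : Graph → (k : ℕ) → .{{NonZero k}} → Graph
G ^□ suc zero    = G
G ^□ suc (suc k) = G ^□ suc k □ G

-- Vertex sets are represented as subsets of the index set Fin (order G).

Independent : (G : Graph) → Subset (order G) → Set
Independent G S = ∀ i j → i ∈ S → j ∈ S → ¬ (vertex i ~ vertex j)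
  where open Graph G

independent? : (G : Graph) → Unary.Decidable (Independent G)
independent? G S =
  all? λ i → all? λ j → (i ∈? S) →-dec ((j ∈? S) →-dec ¬? (vertex i ~? vertex j))
  where open Graph G

subsets : (n : ℕ) → List (Subset n)
subsets zero    = [] ∷ []
subsets (suc n) = List.map (outside ∷_) (subsets n) ++ List.map (inside ∷_) (subsets n)

maximumIndependent : (G : Graph) → Subset (order G)
maximumIndependent G = argmax ∣_∣ ∅ (filter (independent? G) (subsets (order G)))

α : Graph → ℕ
α G = ∣ maximumIndependent G ∣

∈-subsets : ∀ {n} (S : Subset n) → S ∈ˡ subsets n
∈-subsets []            = here refl
∈-subsets (outside ∷ S) = ∈-++⁺ˡ (∈-map⁺ (outside ∷_) (∈-subsets S))
∈-subsets (inside ∷ S)  = ∈-++⁺ʳ _ (∈-map⁺ (inside ∷_) (∈-subsets S))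

α-attained : ∀ G → ∃ λ S → Independent G S × ∣ S ∣ ≡ α G
α-attained G = maximumIndependent G , independent , refl
  where
  independent : Independent G (maximumIndependent G)
  independent = argmax-all ∣_∣ {P = Independent G} {⊥ = ∅}
    (λ _ _ i∈∅ _ _ → ∉⊥ i∈∅) (all-filter (independent? G) (subsets (order G)))

α-upper : ∀ G S → Independent G S → ∣ S ∣ ≤ α G
α-upper G S indep = All.lookup
  (f[xs]≤f[argmax] {f = ∣_∣} ∅ (filter (independent? G) (subsets (order G))))
  (∈-filter⁺ (independent? G) (∈-subsets S) indep)

{-# OPTIONS --safe #-}
module Submission where

-- An independent set of W₅ □ W₅ with s₀, s₁, s₂ elements having 0, 1, 2 hub coordinates satisfies
-- 2 s₀ + 3 s₁ + 2 s₂ ≤ 22.  An independent set of the cube is, in each of the three directions, a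
-- closed walk of five such sets (the rim slices), consecutive ones being disjoint, together with a
-- hub slice disjoint from all of them.  When the hub slice is large, the 5-cycle is an obstruction:
-- the rim slices cannot all attain 22, or almost so.  These finitely many obstructions, which are
-- found by exhaustive search, leave only finitely many integer vectors of counts, on which linear
-- inequalities for the cube hold; their coefficients are those of a dual solution of the linear
-- program for the counts in W₅ ^□ 4.  Summing them over the four directions bounds the size by
-- 343 + 2/3 when the vertex with four hub coordinates is missing, and by 343 + 1/2 otherwise.

open import Defs
open import Data.Bool.Base using (Bool; T; true; false; not; _∧_; _∨_; if_then_else_)
open import Data.Empty using (⊥; ⊥-elim)
open import Data.Fin.Base using (Fin; zero; suc; _↑ˡ_; _↑ʳ_; combine)
open import Data.Fin.Patterns using (0F; 1F; 2F; 3F; 4F)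
open import Data.Fin.Properties using (all?)
open import Data.Fin.Subset using (Subset; ∣_∣)
open import Data.List.Base using (List; []; _∷_; concatMap; filterᵇ; map; null; upTo)
open import Data.List.Membership.Propositional using (_∈_)
open import Data.List.Membership.Propositional.Properties
  using (∈-++⁺ˡ; ∈-++⁺ʳ; ∈-map⁺; ∈-upTo⁺)
open import Data.List.Relation.Unary.Any using (here; there)
open import Data.Nat.Base
open import Data.Nat.Properties
open import Algebra.Properties.CommutativeSemigroup +-commutativeSemigroup using (interchange)
open import Data.Nat.Tactic.RingSolver using (solve-∀)
open import Data.Product.Base using (_×_; _,_; proj₁; proj₂; ∃)
open import Data.Sum.Base using (_⊎_; inj₁; inj₂)
open import Data.Unit.Base using (⊤; tt)
open import Data.Vec.Base as Vec using (Vec; []; _∷_; lookup; replicate)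
open import Data.Vec.Properties using (lookup⇒[]=)
open import Function.Bundles using (Inverse)
open import Relation.Binary.PropositionalEquality
open import Relation.Nullary using (yes; no)
open import Relation.Nullary.Decidable using (_→-dec_; toWitness)

open Graph W₅ using () renaming (_~_ to _~₁_)

private variable
  A B : Set
  f g : Graph.Vertex W₅ → ℕ
  n : ℕ

-- A vertex with j hub coordinates lies in a rim slice in 4 - j directions and in the hub slice in
-- the other j. A pair of inequalities, one for rim slices and one for hub slices, bounds the total
-- as soon as a weighted sum of both over the four directions gives one common coefficient to all
-- levels still in play. The vertex with four hub coordinates decides which pair is available. If
-- present, it excludes every vertex with three hub coordinates, so no rim slice contains its own
-- all-hub vertex. If absent, rim slices may contain theirs, and their inequality charges for it
-- with the weight 18. The searches stay small because each rim can be rotated separately without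
-- changing independence or any count. A few cells of the hub slice, in a fixed position, then
-- suffice to constrain the rim slices.

V : Set
V = Graph.Vertex W₅

pattern rim i = inj₁ i
pattern hub   = inj₂ tt

rims : Vec V 5
rims = rim 0F ∷ rim 1F ∷ rim 2F ∷ rim 3F ∷ rim 4F ∷ []

-- Bounded search over lists

∧-intro : ∀ {a b} → a ≡ true → b ≡ true → a ∧ b ≡ true
∧-intro refl refl = refl

every : (A → Bool) → List A → Bool
every p []       = true
every p (x ∷ xs) = if p x then every p xs else false

every-∈ : ∀ {p : A → Bool} {x xs} → every p xs ≡ true → x ∈ xs → p x ≡ true
every-∈ {p = p} {xs = y ∷ _} e (here refl) with p y
... | true = refl
every-∈ {p = p} {xs = y ∷ _} e (there x∈) with p y
... | true = every-∈ e x∈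

filterᵇ-∈ : ∀ (p : A → Bool) {x xs} → x ∈ xs → p x ≡ true → x ∈ filterᵇ p xs
filterᵇ-∈ p {xs = y ∷ _} (here refl) px rewrite px = here refl
filterᵇ-∈ p {xs = y ∷ _} (there x∈) px with p y
... | true  = there (filterᵇ-∈ p x∈ px)
... | false = filterᵇ-∈ p x∈ px

concatMap-∈ : ∀ (f : A → List B) {x xs y} → x ∈ xs → y ∈ f x → y ∈ concatMap f xs
concatMap-∈ f (here refl) y∈ = ∈-++⁺ˡ y∈
concatMap-∈ f {xs = z ∷ _} (there x∈) y∈ = ∈-++⁺ʳ (f z) (concatMap-∈ f x∈ y∈)

≤⇒≤ᵇ-true : ∀ {m n} → m ≤ n → (m ≤ᵇ n) ≡ true
≤⇒≤ᵇ-true {m} {n} m≤n with m ≤ᵇ n | ≤⇒≤ᵇ m≤n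
... | true | _ = refl

-- Lines and slices as bit vectors: the hub comes first, then the rim in cyclic order.

Line : Set
Line = Vec Bool 6

Slice : Set
Slice = Vec Line 6

infix 5 _#_ _##_

_#_ : Vec Bool n → Vec Bool n → Bool
[]          # []          = true
(true ∷ xs) # (true ∷ ys) = false
(_ ∷ xs)    # (_ ∷ ys)    = xs # ys

_##_ : Vec Line n → Vec Line n → Bool
[]       ## []       = true
(x ∷ xs) ## (y ∷ ys) = (x # y) ∧ (xs ## ys)

bit : Bool → ℕ
bit b = if b then 1 else 0

bits : Vec Bool n → ℕ
bits bs = Vec.sum (Vec.map bit bs)

-- value weighs a cell of W₅ □ W₅ by 2, 3 or 2 according to its 0, 1 or 2 hub coordinates;
-- its maximum over independent sets is 22.
rimBits hubBit rimValue hubValue : Line → ℕ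
rimBits (h ∷ bs)  = bits bs
hubBit  (h ∷ bs)  = bit h
rimValue ℓ = 2 * rimBits ℓ + 3 * hubBit ℓ
hubValue ℓ = 3 * rimBits ℓ + 2 * hubBit ℓ

rowsValue : Vec Line n → ℕ
rowsValue []       = 0
rowsValue (x ∷ xs) = rimValue x + rowsValue xs

value : Slice → ℕ
value (q ∷ xs) = hubValue q + rowsValue xs

independentᵇ : Line → Bool
independentᵇ (h ∷ a ∷ b ∷ c ∷ d ∷ e ∷ []) =
  not (h ∧ a) ∧ not (h ∧ b) ∧ not (h ∧ c) ∧ not (h ∧ d) ∧ not (h ∧ e) ∧
  not (a ∧ b) ∧ not (b ∧ c) ∧ not (c ∧ d) ∧ not (d ∧ e) ∧ not (e ∧ a)

-- Enumeration of the independent sets of large value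

opaque

  lines : List Line
  lines = filterᵇ independentᵇ (subsets 6)

blank : Line
blank = replicate 6 false

module _ (t : ℕ) where

  -- A rim row has value at most 4, so the n rows still to be chosen add at most 4 * n.
  fill : List Line → Line → ℕ → Vec Line n → List (Vec Line n)
  fill ls prev v []                 = [] ∷ []
  fill ls prev v (_∷_ {n = n} h hs) =
    concatMap (λ x → map (x ∷_) (fill ls x (v + rimValue x) hs))
      (filterᵇ (λ x → (x # h) ∧ (x # prev) ∧ (t ≤ᵇ v + rimValue x + 4 * n)) ls)

  closes : Vec Line 5 → Bool
  closes xs = Vec.head xs # Vec.last xs

  candidatesFrom : List Line → Slice → List Slice
  candidatesFrom ls (h ∷ hs) =
    concatMap (λ q → map (q ∷_)
        (filterᵇ closes (fill (filterᵇ (_# q) ls) (replicate 6 false) (hubValue q) hs)))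
      (filterᵇ (_# h) ls)

  -- The conditions under which `fill` keeps a row, apart from the threshold; `rimValue x ≤ 4` is
  -- added because it makes the pruning by the threshold lossless.
  Fits : List Line → Line → Vec Line n → Vec Line n → Set
  Fits ls prev []       []       = ⊤
  Fits ls prev (h ∷ hs) (x ∷ xs) =
    x ∈ ls × x # h ≡ true × x # prev ≡ true × rimValue x ≤ 4 × Fits ls x hs xs

  rowsValue≤ : ∀ {ls prev} (hs xs : Vec Line n) → Fits ls prev hs xs → rowsValue xs ≤ 4 * n
  rowsValue≤ []       []       _ = z≤n
  rowsValue≤ {n = suc n} (h ∷ hs) (x ∷ xs) (_ , _ , _ , x≤4 , fits) = begin
    rimValue x + rowsValue xs ≤⟨ +-mono-≤ x≤4 (rowsValue≤ hs xs fits) ⟩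
    4 + 4 * n                 ≡⟨ *-suc 4 n ⟨
    4 * suc n                 ∎
    where open ≤-Reasoning

  fill-∈ : ∀ {ls prev v} (hs xs : Vec Line n) → Fits ls prev hs xs →
           t ≤ v + rowsValue xs → xs ∈ fill ls prev v hs
  fill-∈ []       []       _ _ = here refl
  fill-∈ {n = suc n} {v = v} (h ∷ hs) (x ∷ xs) (x∈ , x#h , x#p , x≤4 , fits) t≤ =
    concatMap-∈ _
      (filterᵇ-∈ (λ y → (y # h) ∧ (y # _) ∧ (t ≤ᵇ v + rimValue y + 4 * n)) x∈ (∧-intro x#h (∧-intro x#p (≤⇒≤ᵇ-true
        (≤-trans t≤′ (+-monoʳ-≤ (v + rimValue x) (rowsValue≤ hs xs fits)))))))
      (∈-map⁺ (x ∷_) (fill-∈ hs xs fits t≤′))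
    where
    t≤′ : t ≤ v + rimValue x + rowsValue xs
    t≤′ = subst (t ≤_) (sym (+-assoc v (rimValue x) (rowsValue xs))) t≤

  candidatesFrom-∈ : ∀ {ls h q} (hs xs : Vec Line 5) → q ∈ ls → q # h ≡ true →
    Fits (filterᵇ (_# q) ls) (replicate 6 false) hs xs → closes xs ≡ true →
    t ≤ value (q ∷ xs) → (q ∷ xs) ∈ candidatesFrom ls (h ∷ hs)
  candidatesFrom-∈ {q = q} hs xs q∈ q#h fits close t≤ =
    concatMap-∈ _ (filterᵇ-∈ (_# _) q∈ q#h)
      (∈-map⁺ (q ∷_) (filterᵇ-∈ closes (fill-∈ hs xs fits t≤) close))

opaque

  -- The independent sets of W₅ □ W₅ of value at least t that are disjoint from the second argument.
  candidates : ℕ → Slice → List Slice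
  candidates t = candidatesFrom t lines

-- Arrays indexed by wheel vertices

-- Rim or hub.  #ₖ counts the elements of an array with prescribed parts for the k coordinates.
data Part : Set where
  R H : Part

∑ : Part → (V → ℕ) → ℕ
∑ R f = Vec.sum (Vec.map f rims)
∑ H f = f hub

Array₁ Array₂ Array₃ Array₄ : Set
Array₁ = V → Bool
Array₂ = V → Array₁
Array₃ = V → Array₂
Array₄ = V → Array₃

#₁ : Part → Array₁ → ℕ
#₁ e f = ∑ e λ x → bit (f x)

#₂ : Part → Part → Array₂ → ℕ
#₂ d e g = ∑ d λ x → #₁ e (g x)

#₃ : Part → Part → Part → Array₃ → ℕ
#₃ c d e T = ∑ c λ x → #₂ d e (T x)

#₄ : Part → Part → Part → Part → Array₄ → ℕ
#₄ b c d e X = ∑ b λ x → #₃ c d e (X x)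

Ind₁ : Array₁ → Set
Ind₁ f = ∀ u v → u ~₁ v → f u ≡ true → f v ≡ true → ⊥

Ind₂ : Array₂ → Set
Ind₂ g = (∀ x → Ind₁ (g x)) × (∀ y → Ind₁ (λ x → g x y))

Apart₁ : Array₁ → Array₁ → Set
Apart₁ f g = ∀ x → f x ≡ true → g x ≡ true → ⊥

Apart₂ : Array₂ → Array₂ → Set
Apart₂ f g = ∀ x → Apart₁ (f x) (g x)

line : Array₁ → Line
line f = Vec.map f (hub ∷ rims)

slice : Array₂ → Slice
slice g = Vec.map (λ x → line (g x)) (hub ∷ rims)

line# : ∀ {f g} → Apart₁ f g → (vs : Vec V n) → Vec.map f vs # Vec.map g vs ≡ true
line# apart []       = refl
line# {f = f} {g} apart (v ∷ vs) with f v in fv | g v in gv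
... | true  | true  = ⊥-elim (apart v fv gv)
... | true  | false = line# apart vs
... | false | true  = line# apart vs
... | false | false = line# apart vs

rows## : ∀ {f g} → Apart₂ f g → (vs : Vec V n) →
         Vec.map (λ x → line (f x)) vs ## Vec.map (λ x → line (g x)) vs ≡ true
rows## apart []       = refl
rows## apart (v ∷ vs) = ∧-intro (line# (apart v) (hub ∷ rims)) (rows## apart vs)

slice## : ∀ {f g} → Apart₂ f g → slice f ## slice g ≡ true
slice## apart = rows## apart (hub ∷ rims)

opaque
  unfolding lines

  line-∈ : ∀ f → Ind₁ f → line f ∈ lines
  line-∈ f ind = filterᵇ-∈ independentᵇ (∈-subsets (line f))
    (∧-intro (nand hub (rim 0F) tt) (∧-intro (nand hub (rim 1F) tt) (∧-intro (nand hub (rim 2F) tt)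
    (∧-intro (nand hub (rim 3F) tt) (∧-intro (nand hub (rim 4F) tt)
    (∧-intro (nand (rim 0F) (rim 1F) (inj₁ refl)) (∧-intro (nand (rim 1F) (rim 2F) (inj₁ refl))
    (∧-intro (nand (rim 2F) (rim 3F) (inj₁ refl)) (∧-intro (nand (rim 3F) (rim 4F) (inj₁ refl))
    (nand (rim 4F) (rim 0F) (inj₁ refl)))))))))))
    where
    nand : ∀ u v → u ~₁ v → not (f u ∧ f v) ≡ true
    nand u v u~v with f u in fu | f v in fv
    ... | true  | true  = ⊥-elim (ind u v u~v fu fv)
    ... | true  | false = refl
    ... | false | _     = refl

≤ᵇ-true⇒≤ : ∀ {m n} → (m ≤ᵇ n) ≡ true → m ≤ n
≤ᵇ-true⇒≤ {m} {n} e = ≤ᵇ⇒≤ m n (subst T (sym e) tt)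

line-every : ∀ (p : Line → Bool) → every p lines ≡ true → ∀ f → Ind₁ f → p (line f) ≡ true
line-every p e f ind = every-∈ {p = p} e (line-∈ f ind)

opaque
  unfolding lines

  rimValue≤4ᵇ : every (λ ℓ → rimValue ℓ ≤ᵇ 4) lines ≡ true
  rimValue≤4ᵇ = refl

rimValue≤4 : ∀ f → Ind₁ f → rimValue (line f) ≤ 4
rimValue≤4 f ind = ≤ᵇ-true⇒≤ (line-every (λ ℓ → rimValue ℓ ≤ᵇ 4) rimValue≤4ᵇ f ind)

#blank : (xs : Vec Bool n) → xs # replicate n false ≡ true
#blank []           = refl
#blank (true ∷ xs)  = #blank xs
#blank (false ∷ xs) = #blank xs

opaque
  unfolding candidates

  -- Completeness is the direction on which the checks rely: a surplus slice in the list could only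
  -- make them fail.
  slice-∈ : ∀ t g h → Ind₂ g → Apart₂ g h → t ≤ value (slice g) →
            slice g ∈ candidates t (slice h)
  slice-∈ t g h (rowInd , colInd) apart t≤ =
    candidatesFrom-∈ t _ _ (line-∈ (g hub) (rowInd hub)) (avoid hub) fits
      (adj (rim 0F) (rim 4F) (inj₂ refl)) t≤
    where
    adj : ∀ u v → u ~₁ v → line (g u) # line (g v) ≡ true
    adj u v u~v = line# {f = g u} {g v} (λ y → colInd y u v u~v) (hub ∷ rims)
    avoid : ∀ u → line (g u) # line (h u) ≡ true
    avoid u = line# {f = g u} {h u} (apart u) (hub ∷ rims)
    row∈ : ∀ i → line (g (rim i)) ∈ filterᵇ (_# line (g hub)) lines
    row∈ i = filterᵇ-∈ (_# line (g hub)) (line-∈ (g (rim i)) (rowInd (rim i))) (adj (rim i) hub tt)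
    ≤4 : ∀ i → rimValue (line (g (rim i))) ≤ 4
    ≤4 i = rimValue≤4 (g (rim i)) (rowInd (rim i))
    fits : Fits t (filterᵇ (_# line (g hub)) lines) (replicate 6 false)
      (Vec.map (λ x → line (h x)) rims) (Vec.map (λ x → line (g x)) rims)
    fits = row∈ 0F , avoid (rim 0F) , #blank (line (g (rim 0F))) , ≤4 0F ,
           row∈ 1F , avoid (rim 1F) , adj (rim 1F) (rim 0F) (inj₂ refl) , ≤4 1F ,
           row∈ 2F , avoid (rim 2F) , adj (rim 2F) (rim 1F) (inj₂ refl) , ≤4 2F ,
           row∈ 3F , avoid (rim 3F) , adj (rim 3F) (rim 2F) (inj₂ refl) , ≤4 3F ,
           row∈ 4F , avoid (rim 4F) , adj (rim 4F) (rim 3F) (inj₂ refl) , ≤4 4F , tt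

-- Exhaustive searches for closed walks

opaque

  -- `P` is what every closed walk has to satisfy; the constant `false` says that there is none. The
  -- closing condition is imposed on `cs₄` once per `c₀`, outside the inner loops.
  noClosedWalk : (cs₀ cs₁ cs₂ cs₃ cs₄ : List Slice) →
                 (Slice → Slice → Slice → Slice → Slice → Bool) → Bool
  noClosedWalk cs₀ cs₁ cs₂ cs₃ cs₄ P =
    every (λ c₀ → from c₀ (filterᵇ (c₀ ##_) cs₄)) cs₀
    where
    from : Slice → List Slice → Bool
    from c₀ ds₄ =
      every (λ c₁ → every (λ c₂ → every (λ c₃ → every (P c₀ c₁ c₂ c₃)
        (filterᵇ (c₃ ##_) ds₄)) (filterᵇ (c₂ ##_) cs₃)) (filterᵇ (c₁ ##_) cs₂)) (filterᵇ (c₀ ##_) cs₁)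

point₀ pair₀ : Line
point₀  = false ∷ true ∷ replicate 4 false
pair₀   = false ∷ true ∷ false ∷ true ∷ false ∷ false ∷ []

none : Array₂
none _ _ = false

opaque
  unfolding lines candidates

  none≥23 : null (candidates 23 (slice none)) ≡ true
  none≥23 = refl

bothHubs : Slice → Bool
bothHubs (q ∷ _) = Vec.head q

oneHub : Slice → ℕ
oneHub (q ∷ xs) = rimBits q + Vec.sum (Vec.map hubBit xs)

rimRim : Slice → ℕ
rimRim (q ∷ xs) = Vec.sum (Vec.map rimBits xs)

infixr 6 _∪_
_∪_ : Slice → Slice → Slice
_∪_ = Vec.zipWith (Vec.zipWith _∨_)

maxRims : List Line → ℕ
maxRims []       = 0
maxRims (x ∷ xs) = rimBits x ⊔ maxRims xs

-- Bounds an independent set avoiding the given rows by maximising row by row.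
capacity : ∀ {n} → List Line → Vec Line n → ℕ
capacity ls []       = 0
capacity ls (u ∷ us) = maxRims (filterᵇ (_# u) ls) + capacity ls us

-- Cells of the hub slice assumed occupied, up to rotation, and hence missed by all rim slices: one
-- cell on each of the two hub lines, or a full pair on each.
cornerMarks pairMarks : Array₂
cornerMarks hub      (rim 0F) = true
cornerMarks (rim 0F) hub      = true
cornerMarks _        _        = false
pairMarks hub      (rim 0F) = true
pairMarks hub      (rim 2F) = true
pairMarks (rim 0F) hub      = true
pairMarks (rim 2F) hub      = true
pairMarks _        _        = false

-- The first two rows of the union are dropped: the hub row, and the rim row blocked by a hub cell.
corner-noWalk : List Line → List Slice → Bool
corner-noWalk ls cs = noClosedWalk (filterᵇ bothHubs cs) cs cs cs cs λ c₀ c₁ c₂ c₃ c₄ →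
  2 * capacity ls (Vec.tail (Vec.tail (c₀ ∪ c₁ ∪ c₂ ∪ c₃ ∪ c₄))) <ᵇ
    Vec.sum (Vec.map oneHub (c₀ ∷ c₁ ∷ c₂ ∷ c₃ ∷ c₄ ∷ []))

pairs-noWalk : List Slice → Bool
pairs-noWalk cs = noClosedWalk (filterᵇ bothHubs cs) cs cs cs cs λ _ _ _ _ _ → false

nine-noWalk : List Slice → Bool
nine-noWalk cs = noClosedWalk cs cs cs cs cs λ _ _ _ _ _ → false

fulls nonempties : List Line
fulls      = filterᵇ (λ ℓ → rimBits ℓ ≡ᵇ 2) lines
nonempties = filterᵇ (λ ℓ → 1 ≤ᵇ rimBits ℓ) lines

-- The two conjuncts refute the two alternatives of `tightPattern`, read as the `rimRim` counts
-- along the walk.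
ten-noWalk : List Slice → Bool
ten-noWalk cs = split cs (of 5) (of 4)
  where
  of : ℕ → List Slice
  of k = filterᵇ (λ c → rimRim c ≡ᵇ k) cs
  split : List Slice → List Slice → List Slice → Bool
  split cs fives fours =
    noClosedWalk fives fives fives cs cs
      (λ _ _ _ c₃ c₄ → rimRim c₃ + rimRim c₄ <ᵇ 8) ∧
    noClosedWalk fives fives fours fives fours (λ _ _ _ _ _ → false)

-- A total of at least 109 = 5 * 22 - 1 leaves each rim slice a value of at least 21. The threshold
-- 18 = 2 * 3 + 3 * 4 is the least value compatible with the filter in `tenᵇ`.
nineᵇ tenᵇ : Slice → Bool
nineᵇ h = nine-noWalk (candidates 21 h)
tenᵇ h = ten-noWalk (filterᵇ (λ c → (oneHub c ≡ᵇ 4) ∧ (3 ≤ᵇ rimRim c)) (candidates 18 h))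

-- Up to rotation, a hub slice with rim rows of sizes 2, 2, 2, 2 and k starts with pair₀.
overHubs : (Slice → Bool) → List Line → List Line → Bool
overHubs p fs es =
  every (λ r₁ → every (λ r₂ → every (λ r₃ → every (λ r₄ → p (blank ∷ pair₀ ∷ r₁ ∷ r₂ ∷ r₃ ∷ r₄ ∷ []))
    (filterᵇ (λ ℓ → (ℓ # r₃) ∧ (ℓ # pair₀)) es)) (filterᵇ (_# r₂) fs)) (filterᵇ (_# r₁) fs)) (filterᵇ (_# pair₀) fs)

opaque
  unfolding lines candidates noClosedWalk

  corner-check : corner-noWalk (filterᵇ (_# point₀) lines) (candidates 22 (slice cornerMarks)) ≡ true
  corner-check = refl

  pairs-check : pairs-noWalk (candidates 22 (slice pairMarks)) ≡ true
  pairs-check = refl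

  nine-check : overHubs nineᵇ fulls nonempties ≡ true
  nine-check = refl

  ten-check : overHubs tenᵇ fulls fulls ≡ true
  ten-check = refl

-- Sums over parts and rotations of the rim

∑-cong : ∀ e {f g : V → ℕ} → (∀ x → f x ≡ g x) → ∑ e f ≡ ∑ e g
∑-cong R {f} {g} eq = go rims
  where
  go : (xs : Vec V n) → Vec.sum (Vec.map f xs) ≡ Vec.sum (Vec.map g xs)
  go []       = refl
  go (x ∷ xs) = cong₂ _+_ (eq x) (go xs)
∑-cong H eq = eq hub

∑-+ : ∀ e (f g : V → ℕ) → ∑ e (λ x → f x + g x) ≡ ∑ e f + ∑ e g
∑-+ R f g = go rims
  where
  go : (xs : Vec V n) → Vec.sum (Vec.map (λ x → f x + g x) xs) ≡ Vec.sum (Vec.map f xs) + Vec.sum (Vec.map g xs)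
  go []       = refl
  go (x ∷ xs) = trans (cong (f x + g x +_) (go xs)) (interchange (f x) (g x) _ _)
∑-+ H f g = refl

∑-* : ∀ e k (f : V → ℕ) → ∑ e (λ x → k * f x) ≡ k * ∑ e f
∑-* R k f = go rims
  where
  go : (xs : Vec V n) → Vec.sum (Vec.map (λ x → k * f x) xs) ≡ k * Vec.sum (Vec.map f xs)
  go []       = sym (*-zeroʳ k)
  go (x ∷ xs) = trans (cong (k * f x +_) (go xs)) (sym (*-distribˡ-+ k (f x) _))
∑-* H k f = refl

∑-swap : ∀ d e (F : V → V → ℕ) → ∑ d (λ x → ∑ e (F x)) ≡ ∑ e (λ y → ∑ d (λ x → F x y))
∑-swap H e F = refl
∑-swap R H F = refl
∑-swap R R F = go rims
  where
  zeros : (xs : Vec V n) → Vec.sum (Vec.map (λ _ → 0) xs) ≡ 0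
  zeros []       = refl
  zeros (_ ∷ xs) = zeros xs
  go : (xs : Vec V n) → Vec.sum (Vec.map (λ x → ∑ R (F x)) xs) ≡ ∑ R (λ y → Vec.sum (Vec.map (λ x → F x y) xs))
  go []       = refl
  go (x ∷ xs) = trans (cong (∑ R (F x) +_) (go xs)) (sym (∑-+ R (F x) (λ y → Vec.sum (Vec.map (λ x → F x y) xs))))

∑-≤ : ∀ {k} → (∀ i → f (rim i) ≤ k) → ∑ R f ≤ 5 * k
∑-≤ f≤ = +-mono-≤ (f≤ 0F) (+-mono-≤ (f≤ 1F) (+-mono-≤ (f≤ 2F) (+-mono-≤ (f≤ 3F) (+-mono-≤ (f≤ 4F) z≤n))))

next : Fin 5 → Fin 5
next 0F = 1F
next 1F = 2F
next 2F = 3F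
next 3F = 4F
next 4F = 0F

rot : V → V
rot (rim i) = rim (next i)
rot hub     = hub

nexts : ℕ → Fin 5 → Fin 5
nexts zero    i = i
nexts (suc n) i = nexts n (next i)

shift : ℕ → V → V
shift n (rim i) = rim (nexts n i)
shift n hub     = hub

rot-~ : ∀ u v → u ~₁ v → rot u ~₁ rot v
rot-~ (rim i) (rim j) = toWitness {a? = all? λ i → all? λ j → (i ~? j) →-dec (next i ~? next j)} _ i j
  where open Graph C₅ using (_~?_)
rot-~ (rim i) hub     = λ _ → tt
rot-~ hub     (rim j) = λ _ → tt
rot-~ hub     hub     = λ ()

shift-~ : ∀ n u v → u ~₁ v → shift n u ~₁ shift n v
shift-~ zero    (rim i) (rim j) u~v = u~v
shift-~ (suc n) (rim i) (rim j) u~v = shift-~ n (rim (next i)) (rim (next j)) (rot-~ (rim i) (rim j) u~v)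
shift-~ n       (rim i) hub     u~v = tt
shift-~ n       hub     (rim j) u~v = tt

∑-rot : ∀ e f → ∑ e (λ x → f (rot x)) ≡ ∑ e f
∑-rot R f = cycle (f (rim 0F)) (f (rim 1F)) (f (rim 2F)) (f (rim 3F)) (f (rim 4F))
  where
  cycle : ∀ a b c d e → b + (c + (d + (e + (a + 0)))) ≡ a + (b + (c + (d + (e + 0))))
  cycle = solve-∀
∑-rot H f = refl

∑-shift : ∀ n e f → ∑ e (λ x → f (shift n x)) ≡ ∑ e f
∑-shift zero    R f = refl
∑-shift (suc n) R f = trans (∑-rot R (λ x → f (shift n x))) (∑-shift n R f)
∑-shift n       H f = refl

-- The other four values add up to at most `4 * k`. Rotation reduces every position to `rim 0F`.
nearMax : ∀ k d (f : V → ℕ) → (∀ i → f (rim i) ≤ k) → 5 * k ≤ ∑ R f + d → ∀ i → k ≤ f (rim i) + d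
nearMax k d f f≤ total = λ where
    0F → first f f≤ total
    1F → at 1
    2F → at 2
    3F → at 3
    4F → at 4
  where
  open ≤-Reasoning
  first : ∀ f → (∀ i → f (rim i) ≤ k) → 5 * k ≤ ∑ R f + d → k ≤ f (rim 0F) + d
  first f f≤ total = +-cancelʳ-≤ (4 * k) k (f (rim 0F) + d) (begin
    k + 4 * k               ≤⟨ total ⟩
    ∑ R f + d               ≤⟨ +-monoˡ-≤ d (+-monoʳ-≤ (f (rim 0F)) (+-mono-≤ (f≤ 1F)
                                 (+-mono-≤ (f≤ 2F) (+-mono-≤ (f≤ 3F) (+-mono-≤ (f≤ 4F) z≤n))))) ⟩
    f (rim 0F) + 4 * k + d  ≡⟨ regroup (f (rim 0F)) (4 * k) d ⟩
    f (rim 0F) + d + 4 * k  ∎)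
    where
    regroup : ∀ a b c → a + b + c ≡ a + c + b
    regroup = solve-∀
  at : ∀ n → k ≤ f (shift n (rim 0F)) + d
  at n = first (λ x → f (shift n x)) (shift-≤ n)
    (subst (λ s → 5 * k ≤ s + d) (sym (∑-shift n R f)) total)
    where
    shift-≤ : ∀ n i → f (shift n (rim i)) ≤ k
    shift-≤ zero    i = f≤ i
    shift-≤ (suc n) i = shift-≤ n (next i)

∨-true : ∀ {a b} → a ∨ b ≡ true → a ≡ true ⊎ b ≡ true
∨-true {true}  _ = inj₁ refl
∨-true {false} p = inj₂ p

Test : Set
Test = ℕ → ℕ → ℕ → ℕ → ℕ → Bool

someRotation : Test → Test
someRotation g a b c d e = g a b c d e ∨ g b c d e a ∨ g c d e a b ∨ g d e a b c ∨ g e a b c d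

rotatable : ℕ → ℕ → Test → Bool
rotatable k t g =
  every (λ a → every (λ b → every (λ c → every (λ d → every (λ e →
    not (t ≤ᵇ a + (b + (c + (d + (e + 0))))) ∨ someRotation g a b c d e)
    (upTo k)) (upTo k)) (upTo k)) (upTo k)) (upTo k)

holds : Test → (V → ℕ) → Bool
holds g f = g (f (rim 0F)) (f (rim 1F)) (f (rim 2F)) (f (rim 3F)) (f (rim 4F))

-- The enumeration covers all five-tuples below `k`; the index of the true disjunct of
-- `someRotation` is the number of rotation steps.
rotate : ∀ k t g → rotatable k t g ≡ true → ∀ f → (∀ i → f (rim i) < k) → t ≤ ∑ R f →
         ∃ λ n → holds g (λ x → f (shift n x)) ≡ true
rotate k t g check f f< t≤ with t ≤ᵇ ∑ R f in big
  | every-∈ (every-∈ (every-∈ (every-∈ (every-∈ check (∈-upTo⁺ (f< 0F))) (∈-upTo⁺ (f< 1F)))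
      (∈-upTo⁺ (f< 2F))) (∈-upTo⁺ (f< 3F))) (∈-upTo⁺ (f< 4F))
... | false | _ = ⊥-elim (subst T (trans (sym (≤⇒≤ᵇ-true t≤)) big) tt)
... | true  | r with ∨-true r
...   | inj₁ p = 0 , p
...   | inj₂ r with ∨-true r
...     | inj₁ p = 1 , p
...     | inj₂ r with ∨-true r
...       | inj₁ p = 2 , p
...       | inj₂ r with ∨-true r
...         | inj₁ p = 3 , p
...         | inj₂ p = 4 , p

Ind₃ : Array₃ → Set
Ind₃ T = (∀ b c → Ind₁ (λ a → T a b c)) × (∀ a c → Ind₁ (λ b → T a b c)) × (∀ a b → Ind₁ (T a b))

shift₃ : ℕ → ℕ → ℕ → Array₃ → Array₃
shift₃ i j k T a b c = T (shift i a) (shift j b) (shift k c)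

shift₃-Ind : ∀ i j k T → Ind₃ T → Ind₃ (shift₃ i j k T)
shift₃-Ind i j k T (ind₁ , ind₂ , ind₃) =
  (λ b c u v u~v → ind₁ (shift j b) (shift k c) _ _ (shift-~ i u v u~v)) ,
  (λ a c u v u~v → ind₂ (shift i a) (shift k c) _ _ (shift-~ j u v u~v)) ,
  (λ a b u v u~v → ind₃ (shift i a) (shift j b) _ _ (shift-~ k u v u~v))

-- With `shift₃-Ind`, this justifies every normalisation below: the statements to be proved mention
-- only counts, so each coordinate may be rotated at will.
shift₃-# : ∀ i j k c d e T → #₃ c d e (shift₃ i j k T) ≡ #₃ c d e T
shift₃-# i j k c d e T =
  trans (∑-shift i c (λ x → #₂ d e (λ y z → T x (shift j y) (shift k z))))
    (∑-cong c λ x → trans (∑-shift j d (λ y → #₁ e (λ z → T x y (shift k z))))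
      (∑-cong d λ y → ∑-shift k e (λ z → bit (T x y z))))

rowsValue-linear : ∀ (g : Array₂) (xs : Vec V n) →
  rowsValue (Vec.map (λ x → line (g x)) xs) ≡
  2 * Vec.sum (Vec.map (λ x → #₁ R (g x)) xs) + 3 * Vec.sum (Vec.map (λ x → #₁ H (g x)) xs)
rowsValue-linear g []       = refl
rowsValue-linear g (x ∷ xs) =
  trans (cong (rimValue (line (g x)) +_) (rowsValue-linear g xs))
    (regroup (#₁ R (g x)) (#₁ H (g x)) _ _)
  where
  regroup : ∀ a b A B → (2 * a + 3 * b) + (2 * A + 3 * B) ≡ 2 * (a + A) + 3 * (b + B)
  regroup = solve-∀

value-slice : ∀ g → value (slice g) ≡ 2 * #₂ R R g + 3 * (#₂ H R g + #₂ R H g) + 2 * #₂ H H g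
value-slice g = trans (cong (hubValue (line (g hub)) +_) (rowsValue-linear g rims))
  (regroup (#₂ R R g) (#₂ R H g) (#₂ H R g) (#₂ H H g))
  where
  regroup : ∀ a b c d → (3 * c + 2 * d) + (2 * a + 3 * b) ≡ 2 * a + 3 * (c + b) + 2 * d
  regroup = solve-∀

∑-value : ∀ e T → ∑ e (λ x → value (slice (T x))) ≡
  2 * #₃ e R R T + 3 * (#₃ e H R T + #₃ e R H T) + 2 * #₃ e H H T
∑-value e T = begin
  ∑ e (λ x → value (slice (T x)))
    ≡⟨ ∑-cong e (λ x → value-slice (T x)) ⟩
  ∑ e (λ x → 2 * #₂ R R (T x) + 3 * (#₂ H R (T x) + #₂ R H (T x)) + 2 * #₂ H H (T x))
    ≡⟨ ∑-+ e _ (λ x → 2 * #₂ H H (T x)) ⟩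
  _ ≡⟨ cong₂ _+_ (∑-+ e (λ x → 2 * #₂ R R (T x)) _) (∑-* e 2 _) ⟩
  _ ≡⟨ cong (_+ 2 * #₃ e H H T) (cong₂ _+_ (∑-* e 2 _)
         (trans (∑-* e 3 _) (cong (3 *_) (∑-+ e (λ x → #₂ H R (T x)) _)))) ⟩
  2 * #₃ e R R T + 3 * (#₃ e H R T + #₃ e R H T) + 2 * #₃ e H H T ∎
  where open ≡-Reasoning

∧-elim : ∀ {a b} → a ∧ b ≡ true → a ≡ true × b ≡ true
∧-elim {true} {true} _ = refl , refl

<ᵇ-true⇒< : ∀ {m n} → (m <ᵇ n) ≡ true → m < n
<ᵇ-true⇒< {m} {n} e = <ᵇ⇒< m n (subst T (sym e) tt)

≡ᵇ-true⇒≡ : ∀ {m n} → (m ≡ᵇ n) ≡ true → m ≡ n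
≡ᵇ-true⇒≡ {m} {n} e = ≡ᵇ⇒≡ m n (subst T (sym e) tt)

≡⇒≡ᵇ-true : ∀ {m n} → m ≡ n → (m ≡ᵇ n) ≡ true
≡⇒≡ᵇ-true {zero}  refl = refl
≡⇒≡ᵇ-true {suc m} refl = ≡⇒≡ᵇ-true {m} refl

false≢true : ∀ {A : Set} {b} → b ≡ false → b ≡ true → A
false≢true refl ()

opaque
  unfolding noClosedWalk

  noClosedWalk-sound : ∀ {cs₀ cs₁ cs₂ cs₃ cs₄ P c₀ c₁ c₂ c₃ c₄} →
    noClosedWalk cs₀ cs₁ cs₂ cs₃ cs₄ P ≡ true →
    c₀ ∈ cs₀ → c₁ ∈ cs₁ → c₂ ∈ cs₂ → c₃ ∈ cs₃ → c₄ ∈ cs₄ →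
    c₀ ## c₁ ≡ true → c₁ ## c₂ ≡ true → c₂ ## c₃ ≡ true → c₃ ## c₄ ≡ true → c₀ ## c₄ ≡ true →
    P c₀ c₁ c₂ c₃ c₄ ≡ true
  noClosedWalk-sound check c₀∈ c₁∈ c₂∈ c₃∈ c₄∈ c₀₁ c₁₂ c₂₃ c₃₄ c₀₄ =
    let e₀ = every-∈ check c₀∈
        e₁ = every-∈ e₀ (filterᵇ-∈ _ c₁∈ c₀₁)
        e₂ = every-∈ e₁ (filterᵇ-∈ _ c₂∈ c₁₂)
        e₃ = every-∈ e₂ (filterᵇ-∈ _ c₃∈ c₂₃)
    in every-∈ e₃ (filterᵇ-∈ _ (filterᵇ-∈ _ c₄∈ c₀₄) c₃₄)

overHubs-sound : ∀ p {fs es r₁ r₂ r₃ r₄} → overHubs p fs es ≡ true →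
  r₁ ∈ fs → r₂ ∈ fs → r₃ ∈ fs → r₄ ∈ es →
  r₁ # pair₀ ≡ true → r₂ # r₁ ≡ true → r₃ # r₂ ≡ true → r₄ # r₃ ≡ true → r₄ # pair₀ ≡ true →
  p (blank ∷ pair₀ ∷ r₁ ∷ r₂ ∷ r₃ ∷ r₄ ∷ []) ≡ true
overHubs-sound p check r₁∈ r₂∈ r₃∈ r₄∈ r₁₀ r₂₁ r₃₂ r₄₃ r₄₀ =
  let e₁ = every-∈ check (filterᵇ-∈ _ r₁∈ r₁₀)
      e₂ = every-∈ e₁ (filterᵇ-∈ _ r₂∈ r₂₁)
      e₃ = every-∈ e₂ (filterᵇ-∈ _ r₃∈ r₃₂)
  in every-∈ e₃ (filterᵇ-∈ _ r₄∈ (∧-intro r₄₃ r₄₀))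

-- Rim slices as a closed walk; obstructions in normalised position

value≤22 : ∀ g → Ind₂ g → value (slice g) ≤ 22
value≤22 g ind with value (slice g) ≤? 22
... | yes ≤22 = ≤22
... | no  ≰22 with candidates 23 (slice none) | none≥23 | slice-∈ 23 g none ind (λ _ _ _ ()) (≰⇒> ≰22)
...   | [] | _ | ()

module Walk (T : Array₃) (ind : Ind₃ T) where
  ind₁ = proj₁ ind
  ind₂ = proj₁ (proj₂ ind)
  ind₃ = proj₂ (proj₂ ind)

  sl : V → Slice
  sl x = slice (T x)

  sl-ind : ∀ x → Ind₂ (T x)
  sl-ind x = ind₃ x , λ c → ind₂ x c

  apart : ∀ u v → u ~₁ v → Apart₂ (T u) (T v)
  apart u v u~v x y = ind₁ x y u v u~v

  sl## : ∀ u v → u ~₁ v → sl u ## sl v ≡ true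
  sl## u v u~v = slice## {f = T u} {T v} (apart u v u~v)

  closed : ∀ {cs₀ cs₁ cs₂ cs₃ cs₄ P} → noClosedWalk cs₀ cs₁ cs₂ cs₃ cs₄ P ≡ true →
    sl (rim 0F) ∈ cs₀ → sl (rim 1F) ∈ cs₁ → sl (rim 2F) ∈ cs₂ → sl (rim 3F) ∈ cs₃ → sl (rim 4F) ∈ cs₄ →
    P (sl (rim 0F)) (sl (rim 1F)) (sl (rim 2F)) (sl (rim 3F)) (sl (rim 4F)) ≡ true
  closed check ∈₀ ∈₁ ∈₂ ∈₃ ∈₄ = noClosedWalk-sound check ∈₀ ∈₁ ∈₂ ∈₃ ∈₄
    (sl## (rim 0F) (rim 1F) (inj₁ refl)) (sl## (rim 1F) (rim 2F) (inj₁ refl))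
    (sl## (rim 2F) (rim 3F) (inj₁ refl)) (sl## (rim 3F) (rim 4F) (inj₁ refl))
    (sl## (rim 0F) (rim 4F) (inj₂ refl))

  F : ℕ
  F = ∑ R λ x → value (sl x)

  F≤110 : F ≤ 110
  F≤110 = ∑-≤ {f = λ x → value (sl x)} λ i → value≤22 (T (rim i)) (sl-ind (rim i))

  -- Here `d` is the deficit of the whole walk from 110, which a single slice may have to bear
  -- alone. The array `h` can be any set missed by the rim slices, so partial knowledge of the hub
  -- slice is enough.
  rimSlice-∈ : ∀ d t → 110 ≤ F + d → t + d ≡ 22 → ∀ h → (∀ i → Apart₂ (T (rim i)) h) →
               ∀ i → sl (rim i) ∈ candidates t (slice h)
  rimSlice-∈ d t total t+d h avoid i = slice-∈ t (T (rim i)) h (sl-ind (rim i)) (avoid i)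
    (+-cancelʳ-≤ d t _ (subst (_≤ value (sl (rim i)) + d) (sym t+d)
      (nearMax 22 d (λ x → value (sl x)) (λ j → value≤22 (T (rim j)) (sl-ind (rim j))) total i)))

maxRims-≥ : ∀ {ℓ ls} → ℓ ∈ ls → rimBits ℓ ≤ maxRims ls
maxRims-≥ (here refl)              = m≤m⊔n _ _
maxRims-≥ {ls = x ∷ _} (there ℓ∈) = ≤-trans (maxRims-≥ ℓ∈) (m≤n⊔m (rimBits x) _)

#-zipWith : ∀ (x a b : Vec Bool n) → x # a ≡ true → x # b ≡ true → x # Vec.zipWith _∨_ a b ≡ true
#-zipWith []           []          []           _  _  = refl
#-zipWith (true ∷ xs)  (false ∷ a) (false ∷ b)  xa xb = #-zipWith xs a b xa xb
#-zipWith (false ∷ xs) (_ ∷ a)     (_ ∷ b)      xa xb = #-zipWith xs a b xa xb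

opaque
  unfolding lines

  rimBits-hubᵇ : every (λ ℓ → not (Vec.head ℓ) ∨ (rimBits ℓ ≡ᵇ 0)) lines ≡ true
  rimBits-hubᵇ = refl

rimBits-hub : ∀ f → Ind₁ f → f hub ≡ true → rimBits (line f) ≡ 0
rimBits-hub f ind fh with f hub | line-every (λ ℓ → not (Vec.head ℓ) ∨ (rimBits ℓ ≡ᵇ 0)) rimBits-hubᵇ f ind
... | true | e = ≡ᵇ-true⇒≡ e

module Corner (T : Array₃) (ind : Ind₃ T)
  (T₁ : T (rim 0F) hub hub ≡ true) (T₂ : T hub (rim 0F) hub ≡ true) (T₃ : T hub hub (rim 0F) ≡ true) where
  open Walk T ind

  ls : List Line
  ls = filterᵇ (_# point₀) lines

  avoid : ∀ i → Apart₂ (T (rim i)) cornerMarks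
  avoid i hub      (rim 0F) t _ = ind₁ hub (rim 0F) (rim i) hub tt t T₃
  avoid i (rim 0F) hub      t _ = ind₁ (rim 0F) hub (rim i) hub tt t T₂

  row : V → Line
  row x = line (T hub x)

  free : ∀ k → row (rim k) # point₀ ≡ true
  free k = line# {f = T hub (rim k)} {cornerMarks hub} apart₀ (hub ∷ rims)
    where
    apart₀ : Apart₁ (T hub (rim k)) (cornerMarks hub)
    apart₀ (rim 0F) t _ = ind₂ hub (rim 0F) (rim k) hub tt t T₃

  used : V → Line
  used x = u 0F ∪₁ u 1F ∪₁ u 2F ∪₁ u 3F ∪₁ u 4F
    where
    infixr 6 _∪₁_
    _∪₁_ : Line → Line → Line
    _∪₁_ = Vec.zipWith _∨_
    u : Fin 5 → Line
    u i = line (T (rim i) x)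

  row#used : ∀ x → row x # used x ≡ true
  row#used x = #-zipWith (row x) _ _ (r 0F) (#-zipWith (row x) _ _ (r 1F) (#-zipWith (row x) _ _ (r 2F)
    (#-zipWith (row x) _ _ (r 3F) (r 4F))))
    where
    r : ∀ i → row x # line (T (rim i) x) ≡ true
    r i = line# {f = T hub x} {T (rim i) x} (apart hub (rim i) tt x) (hub ∷ rims)

  row≤ : ∀ k → rimBits (row (rim k)) ≤ maxRims (filterᵇ (_# used (rim k)) ls)
  row≤ k = maxRims-≥ (filterᵇ-∈ (_# used (rim k))
    (filterᵇ-∈ (_# point₀) (line-∈ (T hub (rim k)) (ind₃ hub (rim k))) (free k)) (row#used (rim k)))

  -- The rim rows of the hub slice avoid column `rim 0F`, because of `T₃`, and the union of the rim
  -- slices. Row `rim 0F` is empty by `T₂`; the other four are bounded separately by `capacity`,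
  -- which the search compares with the number of one-hub cells of the walk.
  corner : 110 ≤ F → 2 * #₃ H R R T < ∑ R (λ x → oneHub (sl x))
  corner 110≤F = ≤-<-trans (*-monoʳ-≤ 2 (+-mono-≤ (≤-reflexive (rimBits-hub (T hub (rim 0F)) (ind₃ hub (rim 0F)) T₂))
      (+-mono-≤ (row≤ 1F) (+-mono-≤ (row≤ 2F) (+-mono-≤ (row≤ 3F) (+-monoˡ-≤ 0 (row≤ 4F)))))))
    (<ᵇ-true⇒< (closed corner-check (filterᵇ-∈ bothHubs (∈cs 0F) T₁) (∈cs 1F) (∈cs 2F) (∈cs 3F) (∈cs 4F)))
    where
    ∈cs : ∀ i → sl (rim i) ∈ candidates 22 (slice cornerMarks)
    ∈cs = rimSlice-∈ 0 22 (≤-trans 110≤F (m≤m+n F 0)) refl cornerMarks avoid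

pairs-impossible : ∀ T (ind : Ind₃ T) → T (rim 0F) hub hub ≡ true →
  T hub (rim 0F) hub ≡ true → T hub (rim 2F) hub ≡ true →
  T hub hub (rim 0F) ≡ true → T hub hub (rim 2F) ≡ true → 110 ≤ Walk.F T ind → ⊥
pairs-impossible T ind T₁ T₂ T₂′ T₃ T₃′ 110≤F =
  false≢true refl (closed pairs-check (filterᵇ-∈ bothHubs (∈cs 0F) T₁) (∈cs 1F) (∈cs 2F) (∈cs 3F) (∈cs 4F))
  where
  open Walk T ind
  avoid : ∀ i → Apart₂ (T (rim i)) pairMarks
  avoid i hub      (rim 0F) t _ = ind₁ hub (rim 0F) (rim i) hub tt t T₃
  avoid i hub      (rim 2F) t _ = ind₁ hub (rim 2F) (rim i) hub tt t T₃′
  avoid i (rim 0F) hub      t _ = ind₁ (rim 0F) hub (rim i) hub tt t T₂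
  avoid i (rim 2F) hub      t _ = ind₁ (rim 2F) hub (rim i) hub tt t T₂′
  ∈cs : ∀ i → sl (rim i) ∈ candidates 22 (slice pairMarks)
  ∈cs = rimSlice-∈ 0 22 (≤-trans 110≤F (m≤m+n F 0)) refl pairMarks avoid

-- Five numbers at most 5 with sum at least 23 match this up to rotation.
tightPattern : Test
tightPattern a b c d e =
  (a ≡ᵇ 5) ∧ (b ≡ᵇ 5) ∧ (c ≡ᵇ 5) ∧ (8 ≤ᵇ d + e) ∨
  (a ≡ᵇ 5) ∧ (b ≡ᵇ 5) ∧ (c ≡ᵇ 4) ∧ (d ≡ᵇ 5) ∧ (e ≡ᵇ 4)

-- The four one-hub cells use up 12 of the value 22, which leaves 10 = 2 * 5.
rimRim≤5 : ∀ g → Ind₂ g → oneHub (slice g) ≡ 4 → rimRim (slice g) ≤ 5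
rimRim≤5 g ind m≡4 = *-cancelˡ-≤ 2 (+-cancelʳ-≤ 12 _ _ (begin
  2 * rimRim (slice g) + 3 * 4              ≡⟨ cong (λ m → 2 * rimRim (slice g) + 3 * m) m≡4 ⟨
  2 * rimRim (slice g) + 3 * oneHub (slice g) ≤⟨ m≤m+n _ _ ⟩
  2 * rimRim (slice g) + 3 * oneHub (slice g) + 2 * #₂ H H g ≡⟨ value-slice g ⟨
  value (slice g)                         ≤⟨ value≤22 g ind ⟩
  22                                      ∎))
  where open ≤-Reasoning

module RotatedHub (T : Array₃) (ind : Ind₃ T) (row₀ : line (T hub (rim 0F)) ≡ pair₀)
  (full : ∀ i → i ≢ 4F → rimBits (line (T hub (rim i))) ≡ 2) where
  open Walk T ind

  row : Fin 5 → Line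
  row i = line (T hub (rim i))

  -- Clearing the hub row only relaxes the constraint on the rim slices, and the search then has to
  -- range over the five rim rows alone.
  rimRows : Array₂
  rimRows hub     = none hub
  rimRows (rim i) = T hub (rim i)

  avoid : ∀ i → Apart₂ (T (rim i)) rimRows
  avoid i (rim j) y t h = ind₁ (rim j) y (rim i) hub tt t h

  row# : ∀ i j → rim i ~₁ rim j → row i # row j ≡ true
  row# i j i~j = line# {f = T hub (rim i)} {T hub (rim j)} (λ y → ind₂ hub y (rim i) (rim j) i~j) (hub ∷ rims)

  row-∈ : ∀ p i → p (row i) ≡ true → row i ∈ filterᵇ p lines
  row-∈ p i = filterᵇ-∈ p (line-∈ (T hub (rim i)) (ind₃ hub (rim i)))

  row#0 : ∀ i → rim i ~₁ rim 0F → row i # pair₀ ≡ true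
  row#0 i i~0 = subst (λ r → row i # r ≡ true) row₀ (row# i 0F i~0)

  two : ∀ i → i ≢ 4F → row i ∈ fulls
  two i i≢4 = row-∈ (λ ℓ → rimBits ℓ ≡ᵇ 2) i (≡⇒≡ᵇ-true (full i i≢4))

  walk : ∀ p {es} → overHubs p fulls es ≡ true → row 4F ∈ es →
         p (blank ∷ pair₀ ∷ row 1F ∷ row 2F ∷ row 3F ∷ row 4F ∷ []) ≡ true
  walk p check ∈₄ = overHubs-sound p check (two 1F λ ()) (two 2F λ ()) (two 3F λ ()) ∈₄
    (row#0 1F (inj₂ refl)) (row# 2F 1F (inj₂ refl)) (row# 3F 2F (inj₂ refl)) (row# 4F 3F (inj₂ refl)) (row#0 4F (inj₁ refl))

  rimRows-slice : slice rimRows ≡ blank ∷ pair₀ ∷ row 1F ∷ row 2F ∷ row 3F ∷ row 4F ∷ []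
  rimRows-slice = cong (λ r → blank ∷ r ∷ row 1F ∷ row 2F ∷ row 3F ∷ row 4F ∷ []) row₀

  nine-impossible : 1 ≤ rimBits (row 4F) → 109 ≤ F → ⊥
  nine-impossible 1≤ 109≤F = false≢true refl (closed (walk nineᵇ nine-check (row-∈ (λ ℓ → 1 ≤ᵇ rimBits ℓ) 4F (≤⇒≤ᵇ-true 1≤)))
      (∈cs 0F) (∈cs 1F) (∈cs 2F) (∈cs 3F) (∈cs 4F))
    where
    ∈cs : ∀ i → sl (rim i) ∈ candidates 21 (blank ∷ pair₀ ∷ row 1F ∷ row 2F ∷ row 3F ∷ row 4F ∷ [])
    ∈cs i = subst (λ h → sl (rim i) ∈ candidates 21 h) rimRows-slice
      (rimSlice-∈ 1 21 (+-monoˡ-≤ 1 109≤F) refl rimRows avoid i)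

  ten-impossible : rimBits (row 4F) ≡ 2 → (∀ i → oneHub (sl (rim i)) ≡ 4) → 23 ≤ ∑ R (λ x → rimRim (sl x)) →
    holds tightPattern (λ x → rimRim (sl x)) ≡ true → ⊥
  ten-impossible full₄ oneHub≡4 23≤ tight = refute (∨-true tight)
    where
    cs : List Slice
    cs = filterᵇ (λ c → (oneHub c ≡ᵇ 4) ∧ (3 ≤ᵇ rimRim c)) (candidates 18 (blank ∷ pair₀ ∷ row 1F ∷ row 2F ∷ row 3F ∷ row 4F ∷ []))
    3≤ : ∀ i → 3 ≤ rimRim (sl (rim i))
    -- The total 23 = 5 * 5 - 2 leaves a deficit of 2, so each count is at least 5 - 2.
    3≤ i = +-cancelʳ-≤ 2 3 _ (nearMax 5 2 (λ x → rimRim (sl x))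
      (λ j → rimRim≤5 (T (rim j)) (sl-ind (rim j)) (oneHub≡4 j)) (+-monoˡ-≤ 2 23≤) i)
    18≤ : ∀ i → 18 ≤ value (sl (rim i))
    18≤ i = begin
      2 * 3 + 3 * 4                               ≤⟨ +-mono-≤ (*-monoʳ-≤ 2 (3≤ i)) (≤-reflexive (cong (3 *_) (sym (oneHub≡4 i)))) ⟩
      2 * rimRim (sl (rim i)) + 3 * oneHub (sl (rim i)) ≤⟨ m≤m+n _ _ ⟩
      2 * rimRim (sl (rim i)) + 3 * oneHub (sl (rim i)) + 2 * #₂ H H (T (rim i)) ≡⟨ value-slice (T (rim i)) ⟨
      value (sl (rim i))                          ∎
      where open ≤-Reasoning
    ∈cs : ∀ i → sl (rim i) ∈ cs
    ∈cs i = filterᵇ-∈ _ (subst (λ h → sl (rim i) ∈ candidates 18 h) rimRows-slice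
        (slice-∈ 18 (T (rim i)) rimRows (sl-ind (rim i)) (avoid i) (18≤ i)))
      (∧-intro (≡⇒≡ᵇ-true (oneHub≡4 i)) (≤⇒≤ᵇ-true (3≤ i)))
    of : ∀ k i → (rimRim (sl (rim i)) ≡ᵇ k) ≡ true → sl (rim i) ∈ filterᵇ (λ c → rimRim c ≡ᵇ k) cs
    of k i = filterᵇ-∈ (λ c → rimRim c ≡ᵇ k) (∈cs i)
    ok : ten-noWalk cs ≡ true
    ok = walk tenᵇ ten-check (row-∈ (λ ℓ → rimBits ℓ ≡ᵇ 2) 4F (≡⇒≡ᵇ-true full₄))
    c : Fin 5 → ℕ
    c i = rimRim (sl (rim i))
    refute : ((c 0F ≡ᵇ 5) ∧ (c 1F ≡ᵇ 5) ∧ (c 2F ≡ᵇ 5) ∧ (8 ≤ᵇ c 3F + c 4F) ≡ true) ⊎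
             ((c 0F ≡ᵇ 5) ∧ (c 1F ≡ᵇ 5) ∧ (c 2F ≡ᵇ 4) ∧ (c 3F ≡ᵇ 5) ∧ (c 4F ≡ᵇ 4) ≡ true) → ⊥
    refute (inj₁ p) =
      let p₀ , p₁₂ = ∧-elim {c 0F ≡ᵇ 5} p
          p₁ , p₂₃ = ∧-elim {c 1F ≡ᵇ 5} p₁₂
          p₂ , 8≤  = ∧-elim {c 2F ≡ᵇ 5} p₂₃
      in ≤⇒≯ (≤ᵇ-true⇒≤ {8} {c 3F + c 4F} 8≤) (<ᵇ-true⇒< {c 3F + c 4F} {8}
           (closed (proj₁ (∧-elim ok)) (of 5 0F p₀) (of 5 1F p₁) (of 5 2F p₂) (∈cs 3F) (∈cs 4F)))
    refute (inj₂ p) =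
      let p₀ , p₁₂ = ∧-elim {c 0F ≡ᵇ 5} p
          p₁ , p₂₃ = ∧-elim {c 1F ≡ᵇ 5} p₁₂
          p₂ , p₃₄ = ∧-elim {c 2F ≡ᵇ 4} p₂₃
          p₃ , p₄  = ∧-elim {c 3F ≡ᵇ 5} p₃₄
      in false≢true refl (closed (proj₂ (∧-elim ok)) (of 5 0F p₀) (of 5 1F p₁) (of 4 2F p₂) (of 5 3F p₃) (of 4 4F p₄))

-- Obstructions in arbitrary position, by rotation

bit<2 : ∀ b → bit b < 2
bit<2 true  = s≤s (s≤s z≤n)
bit<2 false = s≤s z≤n

bit≡1 : ∀ b → (bit b ≡ᵇ 1) ≡ true → b ≡ true
bit≡1 true _ = refl

occupied : ∀ (f : Array₁) → 1 ≤ #₁ R f → ∃ λ n → f (shift n (rim 0F)) ≡ true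
occupied f 1≤ with rotate 2 1 (λ a _ _ _ _ → a ≡ᵇ 1) refl (λ x → bit (f x)) (λ i → bit<2 (f (rim i))) 1≤
... | n , h = n , bit≡1 (f (shift n (rim 0F))) h

opaque
  unfolding lines

  rimBits≤2ᵇ : every (λ ℓ → rimBits ℓ ≤ᵇ 2) lines ≡ true
  rimBits≤2ᵇ = refl

#₁≤2 : ∀ f → Ind₁ f → #₁ R f ≤ 2
#₁≤2 f ind = ≤ᵇ-true⇒≤ (line-every (λ ℓ → rimBits ℓ ≤ᵇ 2) rimBits≤2ᵇ f ind)

turn : Line → Line
turn (h ∷ a ∷ b ∷ c ∷ d ∷ e ∷ []) = h ∷ b ∷ c ∷ d ∷ e ∷ a ∷ []

turns : ℕ → Line → Line
turns zero    ℓ = ℓ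
turns (suc n) ℓ = turn (turns n ℓ)

line-shift : ∀ n f → line (λ x → f (shift n x)) ≡ turns n (line f)
line-shift zero    f = refl
line-shift (suc n) f = cong turn (line-shift n f)

opaque
  unfolding lines

  -- The five independent pairs of `C₅` form one orbit under rotation. The witnesses follow the
  -- order in which `subsets` lists the pairs.
  fulls-turn : ∀ {ℓ} → ℓ ∈ fulls → ∃ λ n → turns n ℓ ≡ pair₀
  fulls-turn (here refl)                                 = 2 , refl
  fulls-turn (there (here refl))                         = 4 , refl
  fulls-turn (there (there (here refl)))                 = 1 , refl
  fulls-turn (there (there (there (here refl))))         = 3 , refl
  fulls-turn (there (there (there (there (here refl))))) = 0 , refl

pairRotation : ∀ f → Ind₁ f → #₁ R f ≡ 2 → ∃ λ n → line (λ x → f (shift n x)) ≡ pair₀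
pairRotation f ind two with fulls-turn (filterᵇ-∈ (λ ℓ → rimBits ℓ ≡ᵇ 2) (line-∈ f ind) (≡⇒≡ᵇ-true two))
... | n , e = n , trans (line-shift n f) e

value₃ : Array₃ → ℕ
value₃ T = 2 * #₃ R R R T + 3 * (#₃ R H R T + #₃ R R H T) + 2 * #₃ R H H T

value₃-shift : ∀ i j k T → value₃ (shift₃ i j k T) ≡ value₃ T
value₃-shift i j k T
  rewrite shift₃-# i j k R R R T | shift₃-# i j k R H R T | shift₃-# i j k R R H T | shift₃-# i j k R H H T = refl

∑-oneHub : ∀ T → ∑ R (λ x → oneHub (slice (T x))) ≡ #₃ R H R T + #₃ R R H T
∑-oneHub T = ∑-+ R (λ x → #₂ H R (T x)) (λ x → #₂ R H (T x))

shifted-value : ∀ i j k T {m} (ind : Ind₃ T) → m ≤ value₃ T → m ≤ Walk.F (shift₃ i j k T) (shift₃-Ind i j k T ind)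
shifted-value i j k T {m} ind m≤ =
  subst (m ≤_) (sym (trans (∑-value R (shift₃ i j k T)) (value₃-shift i j k T))) m≤

module _ (T : Array₃) (ind : Ind₃ T) where

  private
    ind₂ = proj₁ (proj₂ ind)
    ind₃ = proj₂ (proj₂ ind)

  value₃≤110 : value₃ T ≤ 110
  value₃≤110 = subst (_≤ 110) (∑-value R T) (Walk.F≤110 T ind)

  -- Each hypothesis supplies a cell with a single rim coordinate, in a different direction for
  -- each; three separate rotations bring these cells to the position assumed in `Corner`.
  tight⇒hub-small : 110 ≤ value₃ T → 1 ≤ #₃ R H H T → 1 ≤ #₃ H R H T → 1 ≤ #₃ H H R T →
         2 * #₃ H R R T < #₃ R H R T + #₃ R R H T
  tight⇒hub-small tight u v w
    with i , T₁ ← occupied (λ x → T x hub hub) u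
       | j , T₂ ← occupied (λ x → T hub x hub) v
       | k , T₃ ← occupied (T hub hub) w
    = subst₂ _<_ (cong (2 *_) (shift₃-# i j k H R R T))
        (trans (∑-oneHub T′) (cong₂ _+_ (shift₃-# i j k R H R T) (shift₃-# i j k R R H T)))
        (Corner.corner T′ (shift₃-Ind i j k T ind) T₁ T₂ T₃ (shifted-value i j k T ind tight))
    where
    T′ : Array₃
    T′ = shift₃ i j k T

  tight⇒¬two-pairs : 110 ≤ value₃ T → 1 ≤ #₃ R H H T → #₃ H R H T ≡ 2 → #₃ H H R T ≡ 2 → ⊥
  tight⇒¬two-pairs tight u v w
    with i , T₁ ← occupied (λ x → T x hub hub) u
       | j , ℓ₂ ← pairRotation (λ x → T hub x hub) (ind₂ hub hub) v
       | k , ℓ₃ ← pairRotation (T hub hub) (ind₃ hub hub) w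
    = pairs-impossible (shift₃ i j k T) (shift₃-Ind i j k T ind) T₁
        -- Position 0 of a line is the hub, so positions 1 and 3 are `rim 0F` and `rim 2F`.
        (at 1F ℓ₂) (at 3F ℓ₂) (at 1F ℓ₃) (at 3F ℓ₃) (shifted-value i j k T ind tight)
    where
    at : ∀ (p : Fin 6) {ℓ} → ℓ ≡ pair₀ → Vec.lookup ℓ p ≡ Vec.lookup pair₀ p
    at p = cong (λ ℓ → Vec.lookup ℓ p)

  row : V → ℕ
  row y = #₁ R (T hub y)

  row≤2 : ∀ y → row y ≤ 2
  row≤2 y = #₁≤2 (T hub y) (ind₃ hub y)

  fullRows : Test
  fullRows a b c d e = (a ≡ᵇ 2) ∧ (b ≡ᵇ 2) ∧ (c ≡ᵇ 2) ∧ (d ≡ᵇ 2) ∧ (1 ≤ᵇ e)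

  -- Five rows of size at most 2 with sum at least 9 are all full except possibly one of size 1.
  -- Rotating the second coordinate puts that row last; rotating the third then turns the first row
  -- into `pair₀`.
  nearTight⇒hub<9 : 109 ≤ value₃ T → 9 ≤ #₃ H R R T → ⊥
  nearTight⇒hub<9 tight 9≤ with rotate 3 9 fullRows refl row (λ i → s≤s (row≤2 (rim i))) 9≤
  ... | j , p =
    let p₀ , p = ∧-elim {r 0F ≡ᵇ 2} p
        p₁ , p = ∧-elim {r 1F ≡ᵇ 2} p
        p₂ , p = ∧-elim {r 2F ≡ᵇ 2} p
        p₃ , p₄ = ∧-elim {r 3F ≡ᵇ 2} p
        k , ℓ  = pairRotation (T hub (shift j (rim 0F))) (ind₃ hub (shift j (rim 0F))) (≡ᵇ-true⇒≡ p₀)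
        full : ∀ i → i ≢ 4F → rimBits (line (λ x → T hub (shift j (rim i)) (shift k x))) ≡ 2
        full = λ where
          0F _ → trans (turned k 0F) (≡ᵇ-true⇒≡ p₀)
          1F _ → trans (turned k 1F) (≡ᵇ-true⇒≡ p₁)
          2F _ → trans (turned k 2F) (≡ᵇ-true⇒≡ p₂)
          3F _ → trans (turned k 3F) (≡ᵇ-true⇒≡ p₃)
          4F 4≢4 → ⊥-elim (4≢4 refl)
    in RotatedHub.nine-impossible (shift₃ 0 j k T) (shift₃-Ind 0 j k T ind) ℓ full
         (subst (1 ≤_) (sym (turned k 4F)) (≤ᵇ-true⇒≤ p₄)) (shifted-value 0 j k T ind tight)
    where
    r : Fin 5 → ℕ
    r i = row (shift j (rim i))
    turned : ∀ k i → #₁ R (λ x → T hub (shift j (rim i)) (shift k x)) ≡ r i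
    turned k i = ∑-shift k R (λ x → bit (T hub (shift j (rim i)) x))

  full : #₃ H R R T ≡ 10 → ∀ i → row (rim i) ≡ 2
  full a≡10 i = ≤-antisym (row≤2 (rim i)) (subst (2 ≤_) (+-identityʳ (row (rim i)))
    (nearMax 2 0 row (λ j → row≤2 (rim j)) (≤-reflexive (sym (trans (+-identityʳ _) a≡10))) i))

  oneHub≤4 : ∀ x → oneHub (slice (T x)) ≤ 4
  oneHub≤4 x = +-mono-≤ (#₁≤2 (T x hub) (ind₃ x hub)) (#₁≤2 (λ y → T x y hub) (ind₂ x hub))

  oneHub≡4 : #₃ R H R T + #₃ R R H T ≡ 20 → ∀ i → oneHub (slice (T (rim i))) ≡ 4
  oneHub≡4 t≡20 i = ≤-antisym (oneHub≤4 (rim i)) (subst (4 ≤_) (+-identityʳ (oneHub (slice (T (rim i)))))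
    (nearMax 4 0 (λ x → oneHub (slice (T x))) (λ j → oneHub≤4 (rim j))
      (≤-reflexive (sym (trans (+-identityʳ _) (trans (∑-oneHub T) t≡20)))) i))

holds-cong : ∀ t {f g} → (∀ x → f x ≡ g x) → holds t f ≡ holds t g
holds-cong t eq rewrite eq (rim 0F) | eq (rim 1F) | eq (rim 2F) | eq (rim 3F) | eq (rim 4F) = refl

tightRotation : rotatable 6 23 tightPattern ≡ true
tightRotation = refl

rimRimAt : Array₃ → V → ℕ
rimRimAt T x = rimRim (slice (T x))

hub-ten-shifted : ∀ T i k (ind : Ind₃ (shift₃ i 0 k T)) → 23 ≤ #₃ R R R T → #₃ R H R T + #₃ R R H T ≡ 20 →
  #₃ H R R T ≡ 10 → line (λ z → T hub (rim 0F) (shift k z)) ≡ pair₀ →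
  holds tightPattern (λ x → rimRimAt T (shift i x)) ≡ true → ⊥
hub-ten-shifted T i k ind′ 23≤ t≡20 a≡10 ℓ p =
  RotatedHub.ten-impossible T′ ind′ ℓ (λ b _ → full T′ ind′ a′ b) (full T′ ind′ a′ 4F) (oneHub≡4 T′ ind′ t′)
    (subst (23 ≤_) (sym (shift₃-# i 0 k R R R T)) 23≤) (trans (holds-cong tightPattern {rimRimAt T′} {λ x → rimRimAt T (shift i x)} same) p)
  where
  T′ : Array₃
  T′ = shift₃ i 0 k T
  a′ : #₃ H R R T′ ≡ 10
  a′ = trans (shift₃-# i 0 k H R R T) a≡10
  t′ : #₃ R H R T′ + #₃ R R H T′ ≡ 20
  t′ = trans (cong₂ _+_ (shift₃-# i 0 k R H R T) (shift₃-# i 0 k R R H T)) t≡20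
  same : ∀ x → rimRimAt T′ x ≡ rimRimAt T (shift i x)
  same x = trans (∑-shift 0 R (λ y → ∑ R (λ z → bit (T (shift i x) y (shift k z)))))
    (∑-cong R λ y → ∑-shift k R (λ z → bit (T (shift i x) y z)))

-- The extreme counts force every row of the hub slice to be full and every rim slice to have four
-- one-hub cells. The second coordinate can therefore stay; the first is rotated to reach
-- `tightPattern`, the third to reach `pair₀`.
hub-ten : ∀ T → Ind₃ T → 23 ≤ #₃ R R R T → #₃ R H R T + #₃ R R H T ≡ 20 → #₃ H R R T ≡ 10 → ⊥
hub-ten T ind 23≤ t≡20 a≡10 =
  let k , ℓ = pairRotation (T hub (rim 0F)) (proj₂ (proj₂ ind) hub (rim 0F)) (full T ind a≡10 0F)
      i , p = rotate 6 23 tightPattern tightRotation (rimRimAt T)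
                (λ i → s≤s (rimRim≤5 (T (rim i)) (Walk.sl-ind T ind (rim i)) (oneHub≡4 T ind t≡20 i))) 23≤
  in hub-ten-shifted T i k (shift₃-Ind i 0 k T ind) 23≤ t≡20 a≡10 ℓ p

-- Numerical conditions on the counts of a cube

-- Seen from one direction, the hub slice has a, p + q and h elements with 0, 1 and 2 hub coordinates
-- (p and q according to which one is the hub), and the five rim slices together have s, t and n.
hubᵇ : (a p q h : ℕ) → Bool
hubᵇ a p q h =
  (a + 2 * p ≤ᵇ 10) ∧ (a + 2 * q ≤ᵇ 10) ∧ (2 * a + 3 * (p + q) + 2 * h ≤ᵇ 22) ∧ (p + 2 * h ≤ᵇ 2) ∧ (q + 2 * h ≤ᵇ 2)

-- The bound 110 on the walk, followed by the negations of the four obstructions: corner, two pairs,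
-- hub slice of size at least 9, hub slice of size 10.
walkᵇ : (s t n a p q : ℕ) → Bool
walkᵇ s t n a p q = excess (2 * s + 3 * t + 2 * n)
  where
  excess : ℕ → Bool
  excess f = (f ≤ᵇ 110) ∧
    not ((110 ≤ᵇ f) ∧ (1 ≤ᵇ n) ∧ (1 ≤ᵇ p) ∧ (1 ≤ᵇ q) ∧ (t ≤ᵇ 2 * a)) ∧
    not ((110 ≤ᵇ f) ∧ (1 ≤ᵇ n) ∧ (p ≡ᵇ 2) ∧ (q ≡ᵇ 2)) ∧
    not ((109 ≤ᵇ f) ∧ (9 ≤ᵇ a)) ∧
    not ((23 ≤ᵇ s) ∧ (t ≡ᵇ 20) ∧ (a ≡ᵇ 10))

-- The inequality with 537 serves the rim slices when the four-hub vertex is missing, whatever their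
-- own `h`; the one with 136 then serves the hub slices. When that vertex is present, rim slices
-- have `h` = 0 and use 110, hub slices have `h` = 1 and use 135.
boundsᵇ : (s s₁ s₂ h : ℕ) → Bool
boundsᵇ s s₁ s₂ zero    = (2 * s + 2 * s₁ + s₂ ≤ᵇ 110) ∧ (9 * s + 10 * s₁ + 9 * s₂ ≤ᵇ 537) ∧ (2 * s + 3 * s₁ + 2 * s₂ ≤ᵇ 136)
boundsᵇ s s₁ s₂ (suc _) = (9 * s + 10 * s₁ + 9 * s₂ + 18 ≤ᵇ 537) ∧ (2 * s + 3 * s₁ ≤ᵇ 135)

opaque

  -- s has no hub coordinate; a, b, c count the elements whose only hub coordinate is the first, second,
  -- third one; u, v, w those whose only rim coordinate is the first, second, third one; h all-hub.
  consistent : (hs us as ss : List ℕ) → Bool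
  consistent hs us as ss =
    every (λ h → every (λ u → every (λ v → every (λ w →
      every (λ a → every (λ b → every (λ c → every (λ s →
          if boundsᵇ s (a + b + c) (u + v + w) h then true else
          not (walkᵇ s (b + c) u a v w ∧ walkᵇ s (a + c) v b u w ∧ walkᵇ s (a + b) w c u v))
        ss)
        (filterᵇ (λ c → hubᵇ c u v h) as))
        (filterᵇ (λ b → hubᵇ b u w h) as))
        (filterᵇ (λ a → hubᵇ a v w h) as))
    us) us) us) hs

  -- The ranges exclude their upper ends: a line has at most 2 rim cells, five lines at most 10, and
  -- five slices at most 50.
  consistent-true : consistent (upTo 2) (upTo 3) (upTo 11) (upTo 51) ≡ true
  consistent-true = refl

opaque
  unfolding lines

  lineBoundᵇ : every (λ ℓ → rimBits ℓ + 2 * hubBit ℓ ≤ᵇ 2) lines ≡ true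
  lineBoundᵇ = refl

lineBound : ∀ f → Ind₁ f → #₁ R f + 2 * #₁ H f ≤ 2
lineBound f ind = ≤ᵇ-true⇒≤ (line-every (λ ℓ → rimBits ℓ + 2 * hubBit ℓ ≤ᵇ 2) lineBoundᵇ f ind)

rowsBound : ∀ g → (∀ x → Ind₁ (g x)) → #₂ R R g + 2 * #₂ R H g ≤ 10
rowsBound g ind = subst (_≤ 10)
  (trans (∑-+ R (λ x → #₁ R (g x)) (λ x → 2 * #₁ H (g x))) (cong (#₂ R R g +_) (∑-* R 2 (λ x → #₁ H (g x)))))
  (∑-≤ {f = λ x → #₁ R (g x) + 2 * #₁ H (g x)} {2} λ i → lineBound (g (rim i)) (ind (rim i)))

columnsBound : ∀ g → (∀ y → Ind₁ (λ x → g x y)) → #₂ R R g + 2 * #₂ H R g ≤ 10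
columnsBound g ind = subst (λ s → s + 2 * #₂ H R g ≤ 10) (∑-swap R R λ y x → bit (g x y))
  (rowsBound (λ y x → g x y) ind)

refute : ∀ {b} → (b ≡ true → ⊥) → not b ≡ true
refute {true}  ¬b = ⊥-elim (¬b refl)
refute {false} ¬b = refl

walk-true : ∀ s t n a p q → let f = 2 * s + 3 * t + 2 * n in
  f ≤ 110 →
  (110 ≤ f → 1 ≤ n → 1 ≤ p → 1 ≤ q → 2 * a < t) →
  (110 ≤ f → 1 ≤ n → p ≡ 2 → q ≡ 2 → ⊥) →
  (109 ≤ f → 9 ≤ a → ⊥) →
  (23 ≤ s → t ≡ 20 → a ≡ 10 → ⊥) →
  walkᵇ s t n a p q ≡ true
walk-true s t n a p q f≤ d₂ d₃ d₄ d₅ =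
  ∧-intro (≤⇒≤ᵇ-true f≤)
  (∧-intro (refute λ e → let f≥ , e = ∧-elim e ; n≥ , e = ∧-elim e ; p≥ , e = ∧-elim e ; q≥ , t≤ = ∧-elim e
             in <⇒≱ (d₂ (≤ᵇ-true⇒≤ f≥) (≤ᵇ-true⇒≤ n≥) (≤ᵇ-true⇒≤ p≥) (≤ᵇ-true⇒≤ q≥)) (≤ᵇ-true⇒≤ t≤))
  (∧-intro (refute λ e → let f≥ , e = ∧-elim e ; n≥ , e = ∧-elim e ; p≡ , q≡ = ∧-elim e
             in d₃ (≤ᵇ-true⇒≤ f≥) (≤ᵇ-true⇒≤ n≥) (≡ᵇ-true⇒≡ p≡) (≡ᵇ-true⇒≡ q≡))
  (∧-intro (refute λ e → let f≥ , a≥ = ∧-elim e in d₄ (≤ᵇ-true⇒≤ f≥) (≤ᵇ-true⇒≤ a≥))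
           (refute λ e → let s≥ , e = ∧-elim e ; t≡ , a≡ = ∧-elim e
             in d₅ (≤ᵇ-true⇒≤ s≥) (≡ᵇ-true⇒≡ t≡) (≡ᵇ-true⇒≡ a≡)))))

walkable : Array₃ → Bool
walkable T = walkᵇ (#₃ R R R T) (#₃ R H R T + #₃ R R H T) (#₃ R H H T) (#₃ H R R T) (#₃ H R H T) (#₃ H H R T)

hubbable : Array₃ → Bool
hubbable T = hubᵇ (#₃ H R R T) (#₃ H R H T) (#₃ H H R T) (#₃ H H H T)

walkable-true : ∀ T → Ind₃ T → walkable T ≡ true
walkable-true T ind = walk-true (#₃ R R R T) (#₃ R H R T + #₃ R R H T) (#₃ R H H T) (#₃ H R R T) (#₃ H R H T) (#₃ H H R T)
  (value₃≤110 T ind) (tight⇒hub-small T ind) (tight⇒¬two-pairs T ind) (nearTight⇒hub<9 T ind) (hub-ten T ind)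

hubbable-true : ∀ T → Ind₃ T → hubbable T ≡ true
hubbable-true T (ind₁ , ind₂ , ind₃) =
  ∧-intro (≤⇒≤ᵇ-true (rowsBound (T hub) (ind₃ hub)))
  (∧-intro (≤⇒≤ᵇ-true (columnsBound (T hub) (ind₂ hub)))
  (∧-intro (≤⇒≤ᵇ-true (subst (_≤ 22) (trans (value-slice (T hub)) regrouped) (value≤22 (T hub) (ind₃ hub , ind₂ hub))))
  (∧-intro (≤⇒≤ᵇ-true (lineBound (λ y → T hub y hub) (ind₂ hub hub)))
           (≤⇒≤ᵇ-true (lineBound (T hub hub) (ind₃ hub hub))))))
  where
  regrouped : 2 * #₃ H R R T + 3 * (#₃ H H R T + #₃ H R H T) + 2 * #₃ H H H T ≡
              2 * #₃ H R R T + 3 * (#₃ H R H T + #₃ H H R T) + 2 * #₃ H H H T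
  regrouped = cong (λ s → 2 * #₃ H R R T + 3 * s + 2 * #₃ H H H T) (+-comm (#₃ H H R T) (#₃ H R H T))

second third : Array₃ → Array₃
second T b a c = T a b c
third  T c a b = T a b c

second-Ind : ∀ T → Ind₃ T → Ind₃ (second T)
second-Ind T (ind₁ , ind₂ , ind₃) = (λ a c → ind₂ a c) , (λ b c → ind₁ b c) , (λ b a → ind₃ a b)

third-Ind : ∀ T → Ind₃ T → Ind₃ (third T)
third-Ind T (ind₁ , ind₂ , ind₃) = (λ a b → ind₃ a b) , (λ c b → ind₁ b c) , (λ c a → ind₂ a c)

second-# : ∀ c d e T → #₃ c d e (second T) ≡ #₃ d c e T
second-# c d e T = ∑-swap c d (λ b a → #₁ e (T a b))

third-# : ∀ c d e T → #₃ c d e (third T) ≡ #₃ d e c T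
third-# c d e T = trans (∑-swap c d (λ z x → ∑ e (λ y → bit (T x y z))))
  (∑-cong d λ x → ∑-swap c e (λ z y → bit (T x y z)))

walkᵇ-cong : ∀ {s s′ t t′ n n′ a a′ p p′ q q′} → s ≡ s′ → t ≡ t′ → n ≡ n′ → a ≡ a′ → p ≡ p′ → q ≡ q′ →
             walkᵇ s t n a p q ≡ walkᵇ s′ t′ n′ a′ p′ q′
walkᵇ-cong refl refl refl refl refl refl = refl

hubᵇ-cong : ∀ {a a′ p p′ q q′ h h′} → a ≡ a′ → p ≡ p′ → q ≡ q′ → h ≡ h′ → hubᵇ a p q h ≡ hubᵇ a′ p′ q′ h′
hubᵇ-cong refl refl refl refl = refl

if-true : ∀ {b c} → (if b then true else c) ≡ true → c ≡ false → b ≡ true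
if-true {true}  _ _ = refl
if-true {false} e f = false≢true f e

opaque
  unfolding consistent

  consistent-sound : ∀ {hs us as ss} s a b c u v w h → consistent hs us as ss ≡ true →
    s ∈ ss → a ∈ as → b ∈ as → c ∈ as → u ∈ us → v ∈ us → w ∈ us → h ∈ hs →
    hubᵇ a v w h ≡ true → hubᵇ b u w h ≡ true → hubᵇ c u v h ≡ true →
    walkᵇ s (b + c) u a v w ≡ true → walkᵇ s (a + c) v b u w ≡ true → walkᵇ s (a + b) w c u v ≡ true →
    boundsᵇ s (a + b + c) (u + v + w) h ≡ true
  -- The variables `corner-noWalk` and `pairs-noWalk` bound here are the walk conditions in the
  -- second and third directions.
  consistent-sound s a b c u v w h check s∈ a∈ b∈ c∈ u∈ v∈ w∈ h∈ hub₁ hub₂ hub₃ walk₁ corner-noWalk pairs-noWalk =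
    let e₁ = every-∈ check h∈
        e₂ = every-∈ e₁ u∈
        e₃ = every-∈ e₂ v∈
        e₄ = every-∈ e₃ w∈
        e₅ = every-∈ e₄ (filterᵇ-∈ (λ a → hubᵇ a v w h) a∈ hub₁)
        e₆ = every-∈ e₅ (filterᵇ-∈ (λ b → hubᵇ b u w h) b∈ hub₂)
        e₇ = every-∈ e₆ (filterᵇ-∈ (λ c → hubᵇ c u v h) c∈ hub₃)
        e₈ = every-∈ e₇ s∈
    in if-true e₈ (cong not (∧-intro walk₁ (∧-intro corner-noWalk pairs-noWalk)))

-- The conditions for `T`, `second T` and `third T` are, after reordering the sums, conditions on
-- the same eight counts.
bounds : ∀ T → Ind₃ T → boundsᵇ (#₃ R R R T) (#₃ H R R T + #₃ R H R T + #₃ R R H T)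
  (#₃ R H H T + #₃ H R H T + #₃ H H R T) (#₃ H H H T) ≡ true
bounds T ind@(ind₁ , ind₂ , ind₃) = consistent-sound (#₃ R R R T) (#₃ H R R T) (#₃ R H R T) (#₃ R R H T)
  (#₃ R H H T) (#₃ H R H T) (#₃ H H R T) (#₃ H H H T) consistent-true
  (∈-upTo⁺ (s≤s (∑-≤ {f = λ x → #₂ R R (T x)} {10} λ i → m+n≤o⇒m≤o _ (rowsBound (T (rim i)) (ind₃ (rim i))))))
  (∈-upTo⁺ (s≤s (m+n≤o⇒m≤o _ (rowsBound (T hub) (ind₃ hub)))))
  (∈-upTo⁺ (s≤s (m+n≤o⇒m≤o _ (rowsBound (λ x → T x hub) (λ x → ind₃ x hub)))))
  (∈-upTo⁺ (s≤s (m+n≤o⇒m≤o _ (rowsBound (λ x y → T x y hub) (λ x → ind₂ x hub)))))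
  (∈-upTo⁺ (s≤s (#₁≤2 (λ x → T x hub hub) (ind₁ hub hub))))
  (∈-upTo⁺ (s≤s (#₁≤2 (λ y → T hub y hub) (ind₂ hub hub))))
  (∈-upTo⁺ (s≤s (#₁≤2 (T hub hub) (ind₃ hub hub))))
  (∈-upTo⁺ (bit<2 (T hub hub hub)))
  (hubbable-true T ind)
  (trans (sym (hubᵇ-cong (second-# H R R T) (second-# H R H T) (second-# H H R T) (second-# H H H T)))
    (hubbable-true (second T) (second-Ind T ind)))
  (trans (sym (hubᵇ-cong (third-# H R R T) (third-# H R H T) (third-# H H R T) (third-# H H H T)))
    (hubbable-true (third T) (third-Ind T ind)))
  (walkable-true T ind)
  (trans (sym (walkᵇ-cong (second-# R R R T) (cong₂ _+_ (second-# R H R T) (second-# R R H T))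
      (second-# R H H T) (second-# H R R T) (second-# H R H T) (second-# H H R T)))
    (walkable-true (second T) (second-Ind T ind)))
  (trans (sym (walkᵇ-cong (third-# R R R T) (cong₂ _+_ (third-# R H R T) (third-# R R H T))
      (third-# R H H T) (third-# H R R T) (third-# H R H T) (third-# H H R T)))
    (walkable-true (third T) (third-Ind T ind)))

-- Averaging over the four directions

Ind₄ : Array₄ → Set
Ind₄ X = (∀ b c d → Ind₁ (λ a → X a b c d)) × (∀ a c d → Ind₁ (λ b → X a b c d)) ×
         (∀ a b d → Ind₁ (λ c → X a b c d)) × (∀ a b c → Ind₁ (X a b c))

slice-Ind : ∀ X → Ind₄ X → ∀ a → Ind₃ (X a)
slice-Ind X (ind₁ , ind₂ , ind₃ , ind₄) a = (λ c d → ind₂ a c d) , (λ b d → ind₃ a b d) , (λ b c → ind₄ a b c)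

linear : (α β γ δ x₀ x₁ x₂ x₃ x₄ x₅ x₆ x₇ : ℕ) → ℕ
linear α β γ δ x₀ x₁ x₂ x₃ x₄ x₅ x₆ x₇ = α * x₀ + β * (x₁ + x₂ + x₃) + γ * (x₄ + x₅ + x₆) + δ * x₇

linear₃ : (α β γ δ : ℕ) → Array₃ → ℕ
linear₃ α β γ δ T = linear α β γ δ (#₃ R R R T) (#₃ H R R T) (#₃ R H R T) (#₃ R R H T)
  (#₃ R H H T) (#₃ H R H T) (#₃ H H R T) (#₃ H H H T)

linear₄ : Part → (α β γ δ : ℕ) → Array₄ → ℕ
linear₄ e α β γ δ X = linear α β γ δ (#₄ e R R R X) (#₄ e H R R X) (#₄ e R H R X) (#₄ e R R H X)
  (#₄ e R H H X) (#₄ e H R H X) (#₄ e H H R X) (#₄ e H H H X)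

∑-+₃ : ∀ e (f g h : V → ℕ) → ∑ e (λ x → f x + g x + h x) ≡ ∑ e f + ∑ e g + ∑ e h
∑-+₃ e f g h = trans (∑-+ e (λ x → f x + g x) h) (cong (_+ ∑ e h) (∑-+ e f g))

∑-linear : ∀ e α β γ δ X → ∑ e (λ x → linear₃ α β γ δ (X x)) ≡ linear₄ e α β γ δ X
∑-linear e α β γ δ X =
  trans (∑-+ e (λ x → αs x + βs x + γs x) δs)
    (cong₂ _+_ (trans (∑-+₃ e αs βs γs)
       (cong₂ _+_ (cong₂ _+_ (∑-* e α _) (trans (∑-* e β _) (cong (β *_) (∑-+₃ e _ _ _))))
         (trans (∑-* e γ _) (cong (γ *_) (∑-+₃ e _ _ _)))))
      (∑-* e δ _))
  where
  αs βs γs δs : V → ℕ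
  αs x = α * #₃ R R R (X x)
  βs x = β * (#₃ H R R (X x) + #₃ R H R (X x) + #₃ R R H (X x))
  γs x = γ * (#₃ R H H (X x) + #₃ H R H (X x) + #₃ H H R (X x))
  δs x = δ * #₃ H H H (X x)

rimBound : ∀ α β γ δ k X → (∀ i → linear₃ α β γ δ (X (rim i)) ≤ k) → linear₄ R α β γ δ X ≤ 5 * k
rimBound α β γ δ k X ≤k = subst (_≤ 5 * k) (∑-linear R α β γ δ X) (∑-≤ {f = λ x → linear₃ α β γ δ (X x)} ≤k)

boundsᵇ-0 : ∀ s s₁ s₂ h → h ≡ 0 → boundsᵇ s s₁ s₂ h ≡ true →
  2 * s + 2 * s₁ + s₂ ≤ 110 × 2 * s + 3 * s₁ + 2 * s₂ ≤ 136
boundsᵇ-0 s s₁ s₂ _ refl e =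
  let e₁ , e₂₃ = ∧-elim e
      _ , e₃   = ∧-elim {9 * s + 10 * s₁ + 9 * s₂ ≤ᵇ 537} e₂₃
  in ≤ᵇ-true⇒≤ e₁ , ≤ᵇ-true⇒≤ e₃

boundsᵇ-1 : ∀ s s₁ s₂ h → h ≡ 1 → boundsᵇ s s₁ s₂ h ≡ true → 2 * s + 3 * s₁ ≤ 135
boundsᵇ-1 s s₁ s₂ _ refl e = ≤ᵇ-true⇒≤ (proj₂ (∧-elim {9 * s + 10 * s₁ + 9 * s₂ + 18 ≤ᵇ 537} e))

boundsᵇ-any : ∀ s s₁ s₂ h → h < 2 → boundsᵇ s s₁ s₂ h ≡ true → 9 * s + 10 * s₁ + 9 * s₂ + 18 * h ≤ 537
boundsᵇ-any s s₁ s₂ 0 _ e =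
  let _ , e₂₃ = ∧-elim {2 * s + 2 * s₁ + s₂ ≤ᵇ 110} e
  in ≤-trans (≤-reflexive (+-identityʳ _)) (≤ᵇ-true⇒≤ (proj₁ (∧-elim {9 * s + 10 * s₁ + 9 * s₂ ≤ᵇ 537} e₂₃)))
boundsᵇ-any s s₁ s₂ 1 _ e = ≤ᵇ-true⇒≤ (proj₁ (∧-elim {9 * s + 10 * s₁ + 9 * s₂ + 18 ≤ᵇ 537} e))
boundsᵇ-any s s₁ s₂ (suc (suc _)) (s≤s (s≤s ())) e

module _ (T : Array₃) (ind : Ind₃ T) where

  private
    s s₁ s₂ h : ℕ
    s  = #₃ R R R T
    s₁ = #₃ H R R T + #₃ R H R T + #₃ R R H T
    s₂ = #₃ R H H T + #₃ H R H T + #₃ H H R T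
    h  = #₃ H H H T

    bounded : boundsᵇ s s₁ s₂ h ≡ true
    bounded = bounds T ind

    pad : ∀ x → x + 0 * h ≡ x
    pad x = +-identityʳ x

  weighted-any : linear₃ 9 10 9 18 T ≤ 537
  weighted-any = boundsᵇ-any s s₁ s₂ h (bit<2 (T hub hub hub)) bounded

  module _ (T≡false : T hub hub hub ≡ false) where

    weighted-rim : linear₃ 2 2 1 0 T ≤ 110
    weighted-rim = subst (_≤ 110)
      (trans (cong (2 * s + 2 * s₁ +_) (sym (*-identityˡ s₂))) (sym (pad (2 * s + 2 * s₁ + 1 * s₂))))
      (proj₁ (boundsᵇ-0 s s₁ s₂ h (cong bit T≡false) bounded))

    weighted-hub : linear₃ 2 3 2 0 T ≤ 136
    weighted-hub = subst (_≤ 136) (sym (pad (2 * s + 3 * s₁ + 2 * s₂)))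
      (proj₂ (boundsᵇ-0 s s₁ s₂ h (cong bit T≡false) bounded))

  weighted-full : T hub hub hub ≡ true → linear₃ 2 3 0 0 T ≤ 135
  weighted-full T≡true = subst (_≤ 135)
    (sym (trans (pad (2 * s + 3 * s₁ + 0 * s₂)) (+-identityʳ (2 * s + 3 * s₁))))
    (boundsᵇ-1 s s₁ s₂ h (cong bit T≡true) bounded)

X₂ X₃ X₄ : Array₄ → Array₄
X₂ X b a c d = X a b c d
X₃ X c a b d = X a b c d
X₄ X d a b c = X a b c d

X₂-Ind : ∀ X → Ind₄ X → Ind₄ (X₂ X)
X₂-Ind X (ind₁ , ind₂ , ind₃ , ind₄) =
  (λ a c d → ind₂ a c d) , (λ b c d → ind₁ b c d) , (λ b a d → ind₃ a b d) , (λ b a c → ind₄ a b c)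

X₃-Ind : ∀ X → Ind₄ X → Ind₄ (X₃ X)
X₃-Ind X (ind₁ , ind₂ , ind₃ , ind₄) =
  (λ a b d → ind₃ a b d) , (λ c b d → ind₁ b c d) , (λ c a d → ind₂ a c d) , (λ c a b → ind₄ a b c)

X₄-Ind : ∀ X → Ind₄ X → Ind₄ (X₄ X)
X₄-Ind X (ind₁ , ind₂ , ind₃ , ind₄) =
  (λ a b c → ind₄ a b c) , (λ d b c → ind₁ b c d) , (λ d a c → ind₂ a c d) , (λ d a b → ind₃ a b d)

X₂-# : ∀ X b c d e → #₄ b c d e (X₂ X) ≡ #₄ c b d e X
X₂-# X b c d e = ∑-swap b c (λ y x → #₂ d e (X x y))

X₃-# : ∀ X b c d e → #₄ b c d e (X₃ X) ≡ #₄ c d b e X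
X₃-# X b c d e = trans (∑-swap b c (λ z x → ∑ d λ y → #₁ e (X x y z)))
  (∑-cong c λ x → ∑-swap b d (λ z y → #₁ e (X x y z)))

X₄-# : ∀ X b c d e → #₄ b c d e (X₄ X) ≡ #₄ c d e b X
X₄-# X b c d e = trans (∑-swap b c (λ w x → ∑ d λ y → ∑ e λ z → bit (X x y z w)))
  (∑-cong c λ x → trans (∑-swap b d (λ w y → ∑ e λ z → bit (X x y z w)))
    (∑-cong d λ y → ∑-swap b e (λ w z → bit (X x y z w))))

linear-cong : ∀ α β γ δ {x₀ x₁ x₂ x₃ x₄ x₅ x₆ x₇ y₀ y₁ y₂ y₃ y₄ y₅ y₆ y₇} →
  x₀ ≡ y₀ → x₁ ≡ y₁ → x₂ ≡ y₂ → x₃ ≡ y₃ → x₄ ≡ y₄ → x₅ ≡ y₅ → x₆ ≡ y₆ → x₇ ≡ y₇ →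
  linear α β γ δ x₀ x₁ x₂ x₃ x₄ x₅ x₆ x₇ ≡ linear α β γ δ y₀ y₁ y₂ y₃ y₄ y₅ y₆ y₇
linear-cong α β γ δ refl refl refl refl refl refl refl refl = refl


Counts : Set
Counts = Part → Part → Part → Part → ℕ

module Levels (N : Counts) where

  σ₀ σ₁ σ₂ σ₃ σ₄ : ℕ
  σ₀ = N R R R R
  σ₁ = N H R R R + N R H R R + N R R H R + N R R R H
  σ₂ = N R R H H + N R H R H + N R H H R + N H R R H + N H R H R + N H H R R
  σ₃ = N R H H H + N H R H H + N H H R H + N H H H R
  σ₄ = N H H H H

linearAt : Part → (α β γ δ : ℕ) → Counts → ℕ
linearAt e α β γ δ N = linear α β γ δ (N e R R R) (N e H R R) (N e R H R) (N e R R H)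
  (N e R H H) (N e H R H) (N e H H R) (N e H H H)

N₂ N₃ N₄ : Counts → Counts
N₂ N b c d e = N c b d e
N₃ N b c d e = N c d b e
N₄ N b c d e = N c d e b

counts : Array₄ → Counts
counts X b c d e = #₄ b c d e X

linearAt-cong : ∀ e α β γ δ {N N′ : Counts} → (∀ b c d e → N b c d e ≡ N′ b c d e) →
                linearAt e α β γ δ N ≡ linearAt e α β γ δ N′
linearAt-cong e α β γ δ eq = linear-cong α β γ δ (eq e R R R) (eq e H R R) (eq e R H R) (eq e R R H)
  (eq e R H H) (eq e H R H) (eq e H H R) (eq e H H H)

add₄ : ∀ α β γ δ k x₁ x₂ x₃ x₄ y₁ y₂ y₃ y₄ z₁ z₂ z₃ z₄ w₁ w₂ w₃ w₄ →
  α * x₁ + β * y₁ + γ * z₁ + δ * w₁ ≤ k → α * x₂ + β * y₂ + γ * z₂ + δ * w₂ ≤ k →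
  α * x₃ + β * y₃ + γ * z₃ + δ * w₃ ≤ k → α * x₄ + β * y₄ + γ * z₄ + δ * w₄ ≤ k →
  α * (x₁ + x₂ + x₃ + x₄) + β * (y₁ + y₂ + y₃ + y₄) + γ * (z₁ + z₂ + z₃ + z₄) + δ * (w₁ + w₂ + w₃ + w₄) ≤ k + k + k + k
add₄ α β γ δ k x₁ x₂ x₃ x₄ y₁ y₂ y₃ y₄ z₁ z₂ z₃ z₄ w₁ w₂ w₃ w₄ p₁ p₂ p₃ p₄ =
  ≤-trans (≤-reflexive (trans (cong₂ _+_ (cong₂ _+_ (cong₂ _+_ (d α x₁ x₂ x₃ x₄) (d β y₁ y₂ y₃ y₄)) (d γ z₁ z₂ z₃ z₄)) (d δ w₁ w₂ w₃ w₄))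
    (regroup (α * x₁) (α * x₂) (α * x₃) (α * x₄) (β * y₁) (β * y₂) (β * y₃) (β * y₄)
             (γ * z₁) (γ * z₂) (γ * z₃) (γ * z₄) (δ * w₁) (δ * w₂) (δ * w₃) (δ * w₄))))
    (+-mono-≤ (+-mono-≤ (+-mono-≤ p₁ p₂) p₃) p₄)
  where
  d : ∀ a x y z w → a * (x + y + z + w) ≡ a * x + a * y + a * z + a * w
  d = solve-∀
  regroup : ∀ a₁ a₂ a₃ a₄ b₁ b₂ b₃ b₄ c₁ c₂ c₃ c₄ d₁ d₂ d₃ d₄ →
    (a₁ + a₂ + a₃ + a₄) + (b₁ + b₂ + b₃ + b₄) + (c₁ + c₂ + c₃ + c₄) + (d₁ + d₂ + d₃ + d₄) ≡
    (a₁ + b₁ + c₁ + d₁) + (a₂ + b₂ + c₂ + d₂) + (a₃ + b₃ + c₃ + d₃) + (a₄ + b₄ + c₄ + d₄)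
  regroup = solve-∀

module _ (N : Counts) (α β γ δ k : ℕ) where
  open Levels N

  -- A vertex with j hub coordinates is counted once for each of its 4 - j rim coordinates, whence
  -- the factors 4, 3, 2, 1; in `hubSum` it is counted j times.
  rimSum : linearAt R α β γ δ N ≤ k → linearAt R α β γ δ (N₂ N) ≤ k →
           linearAt R α β γ δ (N₃ N) ≤ k → linearAt R α β γ δ (N₄ N) ≤ k →
           α * (4 * σ₀) + β * (3 * σ₁) + γ * (2 * σ₂) + δ * σ₃ ≤ k + k + k + k
  rimSum p₁ p₂ p₃ p₄ = subst (_≤ k + k + k + k)
    (cong (_+ δ * σ₃) (cong₂ _+_ (cong₂ _+_ (cong (α *_) (four (N R R R R)))
      (cong (β *_) (thrice (N H R R R) (N R H R R) (N R R H R) (N R R R H))))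
      (cong (γ *_) (twice (N R R H H) (N R H R H) (N R H H R) (N H R R H) (N H R H R) (N H H R R)))))
    (add₄ α β γ δ k _ _ _ _ _ _ _ _ _ _ _ _ _ _ _ _ p₁ p₂ p₃ p₄)
    where
    four : ∀ x → x + x + x + x ≡ 4 * x
    four = solve-∀
    thrice : ∀ a b c d → (b + c + d) + (a + c + d) + (a + b + d) + (a + b + c) ≡ 3 * (a + b + c + d)
    thrice = solve-∀
    twice : ∀ a b c d e f →
      (a + b + c) + (a + d + e) + (b + d + f) + (c + e + f) ≡ 2 * (a + b + c + d + e + f)
    twice = solve-∀

  hubSum : linearAt H α β γ δ N ≤ k → linearAt H α β γ δ (N₂ N) ≤ k →
           linearAt H α β γ δ (N₃ N) ≤ k → linearAt H α β γ δ (N₄ N) ≤ k →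
           α * σ₁ + β * (2 * σ₂) + γ * (3 * σ₃) + δ * (4 * σ₄) ≤ k + k + k + k
  hubSum p₁ p₂ p₃ p₄ = subst (_≤ k + k + k + k)
    (cong₂ _+_ (cong₂ _+_ (cong (α * σ₁ +_)
      (cong (β *_) (twice (N R R H H) (N R H R H) (N R H H R) (N H R R H) (N H R H R) (N H H R R))))
      (cong (γ *_) (thrice (N R H H H) (N H R H H) (N H H R H) (N H H H R))))
      (cong (δ *_) (four (N H H H H))))
    (add₄ α β γ δ k _ _ _ _ _ _ _ _ _ _ _ _ _ _ _ _ p₁ p₂ p₃ p₄)
    where
    four : ∀ x → x + x + x + x ≡ 4 * x
    four = solve-∀
    thrice : ∀ a b c d → (b + c + d) + (a + c + d) + (a + b + d) + (a + b + c) ≡ 3 * (a + b + c + d)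
    thrice = solve-∀
    twice : ∀ a b c d e f →
      (f + e + d) + (f + c + b) + (e + c + a) + (d + b + a) ≡ 2 * (a + b + c + d + e + f)
    twice = solve-∀

-- The first inequality plus three times the second gives all four levels the weight 36 = 36 + 0 =
-- 30 + 6 = 18 + 18. The right-hand side 10740 + 3 * 544 = 12372 is less than 36 * 344.
finish-empty : ∀ a b c d e → e ≡ 0 →
  9 * (4 * a) + 10 * (3 * b) + 9 * (2 * c) + 18 * d ≤ 10740 →
  2 * b + 3 * (2 * c) + 2 * (3 * d) + 0 * (4 * e) ≤ 544 →
  a + b + c + d + e ≤ 343
finish-empty a b c d .0 refl p q = ≤-pred (*-cancelˡ-< 36 m 344
  (≤-<-trans {36 * m} {12372} {36 * 344} 36m≤ (≤ᵇ⇒≤ 12373 12384 tt)))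
  where
  m x y : ℕ
  m = a + b + c + d + 0
  x = 9 * (4 * a) + 10 * (3 * b) + 9 * (2 * c) + 18 * d
  y = 2 * b + 3 * (2 * c) + 2 * (3 * d) + 0
  regroup : ∀ a b c d → 36 * (a + b + c + d + 0) ≡
    (9 * (4 * a) + 10 * (3 * b) + 9 * (2 * c) + 18 * d) + 3 * (2 * b + 3 * (2 * c) + 2 * (3 * d) + 0)
  regroup = solve-∀
  36m≤ : 36 * m ≤ 12372
  36m≤ = subst (_≤ 12372) (sym (regroup a b c d))
    (+-mono-≤ {x} {10740} {3 * y} {1632} p (*-monoʳ-≤ 3 {y} {544} q))

-- The plain sum gives the weight 8 = 8 + 0 = 6 + 2 = 2 + 6 to the first three levels, and 2200 +
-- 540 is less than 8 * 343. These levels thus hold at most 342 vertices, and the four-hub vertex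
-- adds one.
finish-full : ∀ a b c d e → d ≡ 0 → e ≡ 1 →
  2 * (4 * a) + 2 * (3 * b) + 1 * (2 * c) + 0 * d ≤ 2200 →
  2 * b + 3 * (2 * c) + 0 * (3 * d) + 0 * (4 * e) ≤ 540 →
  a + b + c + d + e ≤ 343
finish-full a b c .0 .1 refl refl p q = subst (_≤ 343) (+-comm 1 (m + 0)) (s≤s (subst (_≤ 342) (sym (+-identityʳ m)) m≤))
  where
  m x y : ℕ
  m = a + b + c
  x = 2 * (4 * a) + 2 * (3 * b) + 1 * (2 * c) + 0
  y = 2 * b + 3 * (2 * c) + 0 + 0
  regroup : ∀ a b c → 8 * (a + b + c) ≡
    (2 * (4 * a) + 2 * (3 * b) + 1 * (2 * c) + 0) + (2 * b + 3 * (2 * c) + 0 + 0)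
  regroup = solve-∀
  8m≤ : 8 * m ≤ 2740
  8m≤ = subst (_≤ 2740) (sym (regroup a b c)) (+-mono-≤ {x} {2200} {y} {540} p q)
  m≤ : m ≤ 342
  m≤ = ≤-pred (*-cancelˡ-< 8 m 343 (≤-<-trans {8 * m} {2740} {8 * 343} 8m≤ (≤ᵇ⇒≤ 2741 2744 tt)))

module FourCounts (X : Array₄) (ind : Ind₄ X) where
  open Levels (counts X)

  -- Permuting coordinates fixes the all-hub entry. Keeping it in the hypothesis lets one bound that
  -- depends on it serve all four directions.
  AllDirections : Part → (α β γ δ k : ℕ) → Set
  AllDirections e α β γ δ k =
    ∀ Y → Ind₄ Y → Y hub hub hub hub ≡ X hub hub hub hub → linear₄ e α β γ δ Y ≤ k

  permuted : ∀ e α β γ δ k (N : Counts) Y → (∀ b c d e → #₄ b c d e Y ≡ N b c d e) → linear₄ e α β γ δ Y ≤ k →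
             linearAt e α β γ δ N ≤ k
  permuted e α β γ δ k N Y eq = subst (_≤ k) (linearAt-cong e α β γ δ {counts Y} {N} eq)

  rimTotal : ∀ α β γ δ k → AllDirections R α β γ δ k →
    α * (4 * σ₀) + β * (3 * σ₁) + γ * (2 * σ₂) + δ * σ₃ ≤ k + k + k + k
  rimTotal α β γ δ k bound = rimSum (counts X) α β γ δ k
    (bound X ind refl)
    (permuted R α β γ δ k (N₂ (counts X)) (X₂ X) (X₂-# X) (bound (X₂ X) (X₂-Ind X ind) refl))
    (permuted R α β γ δ k (N₃ (counts X)) (X₃ X) (X₃-# X) (bound (X₃ X) (X₃-Ind X ind) refl))
    (permuted R α β γ δ k (N₄ (counts X)) (X₄ X) (X₄-# X) (bound (X₄ X) (X₄-Ind X ind) refl))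

  hubTotal : ∀ α β γ δ k → AllDirections H α β γ δ k →
    α * σ₁ + β * (2 * σ₂) + γ * (3 * σ₃) + δ * (4 * σ₄) ≤ k + k + k + k
  hubTotal α β γ δ k bound = hubSum (counts X) α β γ δ k
    (bound X ind refl)
    (permuted H α β γ δ k (N₂ (counts X)) (X₂ X) (X₂-# X) (bound (X₂ X) (X₂-Ind X ind) refl))
    (permuted H α β γ δ k (N₃ (counts X)) (X₃ X) (X₃-# X) (bound (X₃ X) (X₃-Ind X ind) refl))
    (permuted H α β γ δ k (N₄ (counts X)) (X₄ X) (X₄-# X) (bound (X₄ X) (X₄-Ind X ind) refl))

  total-empty : X hub hub hub hub ≡ false → σ₀ + σ₁ + σ₂ + σ₃ + σ₄ ≤ 343
  total-empty X≡false = finish-empty σ₀ σ₁ σ₂ σ₃ σ₄ (cong bit X≡false)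
    (rimTotal 9 10 9 18 2685 λ Y indY _ →
      rimBound 9 10 9 18 537 Y λ i → weighted-any (Y (rim i)) (slice-Ind Y indY (rim i)))
    (hubTotal 2 3 2 0 136 λ Y indY Y≡ → weighted-hub (Y hub) (slice-Ind Y indY hub) (trans Y≡ X≡false))

  -- The four lines through the four-hub vertex have their hub occupied, hence their rims empty.
  σ₃-full : X hub hub hub hub ≡ true → σ₃ ≡ 0
  σ₃-full X≡true = cong₂ _+_ (cong₂ _+_ (cong₂ _+_
      (rimBits-hub (λ a → X a hub hub hub) (proj₁ ind hub hub hub) X≡true)
      (rimBits-hub (λ b → X hub b hub hub) (proj₁ (proj₂ ind) hub hub hub) X≡true))
      (rimBits-hub (λ c → X hub hub c hub) (proj₁ (proj₂ (proj₂ ind)) hub hub hub) X≡true))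
      (rimBits-hub (X hub hub hub) (proj₂ (proj₂ (proj₂ ind)) hub hub hub) X≡true)

  total-full : X hub hub hub hub ≡ true → σ₀ + σ₁ + σ₂ + σ₃ + σ₄ ≤ 343
  total-full X≡true = finish-full σ₀ σ₁ σ₂ σ₃ σ₄ (σ₃-full X≡true) (cong bit X≡true)
    (rimTotal 2 2 1 0 550 λ Y indY Y≡ → rimBound 2 2 1 0 110 Y λ i →
      weighted-rim (Y (rim i)) (slice-Ind Y indY (rim i)) (corner Y indY i (trans Y≡ X≡true)))
    (hubTotal 2 3 0 0 135 λ Y indY Y≡ → weighted-full (Y hub) (slice-Ind Y indY hub) (trans Y≡ X≡true))
    where
    corner : ∀ Y → Ind₄ Y → ∀ i → Y hub hub hub hub ≡ true → Y (rim i) hub hub hub ≡ false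
    corner Y indY i Y≡true with Y (rim i) hub hub hub in eq
    ... | false = refl
    ... | true  = ⊥-elim (proj₁ indY hub hub hub (rim i) hub tt eq Y≡true)

  total≤343 : σ₀ + σ₁ + σ₂ + σ₃ + σ₄ ≤ 343
  total≤343 = split (X hub hub hub hub) refl
    where
    split : ∀ b → X hub hub hub hub ≡ b → σ₀ + σ₁ + σ₂ + σ₃ + σ₄ ≤ 343
    split true  = total-full
    split false = total-empty

-- From vertex sets to arrays

∑ᵥ : (V → ℕ) → ℕ
∑ᵥ f = ∑ R f + ∑ H f

bothParts : (Part → ℕ) → ℕ
bothParts f = f R + f H

∑-both : ∀ e (F : Part → V → ℕ) → ∑ e (λ x → bothParts λ p → F p x) ≡ bothParts λ p → ∑ e (F p)
∑-both e F = ∑-+ e (F R) (F H)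

∑ᵥ-both : ∀ (F : Part → V → ℕ) → ∑ᵥ (λ x → bothParts λ p → F p x) ≡ bothParts λ e → bothParts λ p → ∑ e (F p)
∑ᵥ-both F = cong₂ _+_ (∑-both R F) (∑-both H F)

bothParts-cong : ∀ {f g : Part → ℕ} → (∀ p → f p ≡ g p) → bothParts f ≡ bothParts g
bothParts-cong eq = cong₂ _+_ (eq R) (eq H)

∑ᵥ-cong : ∀ {f g : V → ℕ} → (∀ x → f x ≡ g x) → ∑ᵥ f ≡ ∑ᵥ g
∑ᵥ-cong eq = cong₂ _+_ (∑-cong R eq) (∑-cong H eq)

∑ᵥ₂ : ∀ (g : Array₂) → ∑ᵥ (λ x → ∑ᵥ λ y → bit (g x y)) ≡ bothParts λ d → bothParts λ e → #₂ d e g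
∑ᵥ₂ g = ∑ᵥ-both λ e x → #₁ e (g x)

∑ᵥ₃ : ∀ (T : Array₃) → ∑ᵥ (λ x → ∑ᵥ λ y → ∑ᵥ λ z → bit (T x y z)) ≡
      bothParts λ c → bothParts λ d → bothParts λ e → #₃ c d e T
∑ᵥ₃ T = trans (∑ᵥ-cong λ x → ∑ᵥ₂ (T x))
  (trans (∑ᵥ-both λ d x → bothParts λ e → #₂ d e (T x))
    (bothParts-cong λ c → bothParts-cong λ d → ∑-both c λ e x → #₂ d e (T x)))

∑ᵥ₄ : ∀ (X : Array₄) → ∑ᵥ (λ x → ∑ᵥ λ y → ∑ᵥ λ z → ∑ᵥ λ w → bit (X x y z w)) ≡
      bothParts λ b → bothParts λ c → bothParts λ d → bothParts λ e → #₄ b c d e X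
∑ᵥ₄ X = trans (∑ᵥ-cong λ x → ∑ᵥ₃ (X x))
  (trans (∑ᵥ-both λ c x → bothParts λ d → bothParts λ e → #₃ c d e (X x))
    (bothParts-cong λ b → bothParts-cong λ c →
      trans (∑-both b λ d x → bothParts λ e → #₃ c d e (X x))
        (bothParts-cong λ d → ∑-both b λ e x → #₃ c d e (X x))))

levels : ∀ N → (bothParts λ b → bothParts λ c → bothParts λ d → bothParts λ e → N b c d e) ≡
  Levels.σ₀ N + Levels.σ₁ N + Levels.σ₂ N + Levels.σ₃ N + Levels.σ₄ N
levels N = regroup (N R R R R) (N R R R H) (N R R H R) (N R R H H) (N R H R R) (N R H R H) (N R H H R) (N R H H H)
  (N H R R R) (N H R R H) (N H R H R) (N H R H H) (N H H R R) (N H H R H) (N H H H R) (N H H H H)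
  where
  regroup : ∀ a b c d e f g h i j k l m n o p →
    (((a + b) + (c + d)) + ((e + f) + (g + h))) + (((i + j) + (k + l)) + ((m + n) + (o + p))) ≡
    a + (i + e + c + b) + (d + f + g + j + k + m) + (h + l + n + o) + p
  regroup = solve-∀

∑ᶠ : ∀ n → (Fin n → ℕ) → ℕ
∑ᶠ zero    f = 0
∑ᶠ (suc n) f = f zero + ∑ᶠ n (λ i → f (suc i))

∑ᶠ-+ : ∀ m n (f : Fin (m + n) → ℕ) → ∑ᶠ (m + n) f ≡ ∑ᶠ m (λ i → f (i ↑ˡ n)) + ∑ᶠ n (λ j → f (m ↑ʳ j))
∑ᶠ-+ zero    n f = refl
∑ᶠ-+ (suc m) n f = trans (cong (f zero +_) (∑ᶠ-+ m n (λ i → f (suc i)))) (sym (+-assoc (f zero) _ _))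

∑ᶠ-* : ∀ m n (f : Fin (m * n) → ℕ) → ∑ᶠ (m * n) f ≡ ∑ᶠ m (λ i → ∑ᶠ n (λ j → f (combine i j)))
∑ᶠ-* zero    n f = refl
∑ᶠ-* (suc m) n f = trans (∑ᶠ-+ n (m * n) f) (cong (∑ᶠ n (λ j → f (j ↑ˡ (m * n))) +_) (∑ᶠ-* m n (λ i → f (n ↑ʳ i))))

∣∣≡∑ᶠ : ∀ {n} (S : Subset n) → ∣ S ∣ ≡ ∑ᶠ n (λ i → bit (lookup S i))
∣∣≡∑ᶠ []          = refl
∣∣≡∑ᶠ (true ∷ S)  = cong suc (∣∣≡∑ᶠ S)
∣∣≡∑ᶠ (false ∷ S) = ∣∣≡∑ᶠ S

index : (G : Graph) → Graph.Vertex G → Fin (Graph.order G)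
index G = Inverse.from (Graph.enum G)

∑ᶠ-W₅ : ∀ (f : Fin 6 → ℕ) → ∑ᶠ 6 f ≡ ∑ᵥ (λ x → f (index W₅ x))
∑ᶠ-W₅ f = regroup (f 0F) (f 1F) (f 2F) (f 3F) (f 4F) _
  where
  regroup : ∀ a b c d e g → a + (b + (c + (d + (e + (g + 0))))) ≡ a + (b + (c + (d + (e + 0)))) + g
  regroup = solve-∀

Enumerates : ∀ G → ((Graph.Vertex G → ℕ) → ℕ) → Set
Enumerates G Ψ = ∀ f → ∑ᶠ (Graph.order G) f ≡ Ψ (λ v → f (index G v))

-- The index of `(v , x)` is by definition `combine` of the two indices, so each further factor
-- contributes one inner sum.
enumerates-□ : ∀ G Ψ → Enumerates G Ψ → Enumerates (G □ W₅) (λ F → Ψ λ v → ∑ᵥ λ x → F (v , x))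
enumerates-□ G Ψ enumerates f = trans (∑ᶠ-* (Graph.order G) 6 f)
  (trans (go (Graph.order G) λ i → ∑ᶠ-W₅ (λ j → f (combine i j)))
    (enumerates λ i → ∑ᵥ λ x → f (combine i (index W₅ x))))
  where
  go : ∀ n {g h : Fin n → ℕ} → (∀ i → g i ≡ h i) → ∑ᶠ n g ≡ ∑ᶠ n h
  go zero    eq = refl
  go (suc n) eq = cong₂ _+_ (eq zero) (go n λ i → eq (suc i))

enumerates-W₅⁴ : Enumerates (W₅ ^□ 4) (λ F → ∑ᵥ λ a → ∑ᵥ λ b → ∑ᵥ λ c → ∑ᵥ λ d → F (((a , b) , c) , d))
enumerates-W₅⁴ = enumerates-□ (W₅ ^□ 3) (λ F → ∑ᵥ λ a → ∑ᵥ λ b → ∑ᵥ λ c → F ((a , b) , c))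
  (enumerates-□ (W₅ ^□ 2) (λ F → ∑ᵥ λ a → ∑ᵥ λ b → F (a , b)) (enumerates-□ W₅ ∑ᵥ ∑ᶠ-W₅))

module _ (S : Subset (Graph.order (W₅ ^□ 4))) (indep : Independent (W₅ ^□ 4) S) where
  open Graph (W₅ ^□ 4) using (enum) renaming (_~_ to _~₄_)

  membership : Array₄
  membership a b c d = lookup S (index (W₅ ^□ 4) (((a , b) , c) , d))

  separated : ∀ u v → u ~₄ v → lookup S (index (W₅ ^□ 4) u) ≡ true → lookup S (index (W₅ ^□ 4) v) ≡ true → ⊥
  separated u v u~v u∈ v∈ = indep (index (W₅ ^□ 4) u) (index (W₅ ^□ 4) v) (lookup⇒[]= _ S u∈) (lookup⇒[]= _ S v∈)
    (subst₂ _~₄_ (sym (Inverse.strictlyInverseˡ enum u)) (sym (Inverse.strictlyInverseˡ enum v)) u~v)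

  membership-Ind : Ind₄ membership
  membership-Ind =
    -- The power is nested to the left, so the first coordinate lies deepest: each `inj₂` keeps the
    -- last remaining coordinate fixed.
    (λ b c d u v u~v → separated (((u , b) , c) , d) (((v , b) , c) , d) (inj₂ (refl , inj₂ (refl , inj₂ (refl , u~v))))) ,
    (λ a c d u v u~v → separated (((a , u) , c) , d) (((a , v) , c) , d) (inj₂ (refl , inj₂ (refl , inj₁ (refl , u~v))))) ,
    (λ a b d u v u~v → separated (((a , b) , u) , d) (((a , b) , v) , d) (inj₂ (refl , inj₁ (refl , u~v)))) ,
    (λ a b c u v u~v → separated (((a , b) , c) , u) (((a , b) , c) , v) (inj₁ (refl , u~v)))

  size≤343 : ∣ S ∣ ≤ 343
  size≤343 = subst (_≤ 343)
    (sym (trans (∣∣≡∑ᶠ S) (trans (enumerates-W₅⁴ (λ i → bit (lookup S i))) (trans (∑ᵥ₄ membership) (levels (counts membership))))))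
    (FourCounts.total≤343 membership membership-Ind)

α-bound : ∀ G k → (∀ S → Independent G S → ∣ S ∣ ≤ k) → α G ≤ k
α-bound G k bound = subst (_≤ k) (proj₂ (proj₂ (α-attained G)))
  (bound (proj₁ (α-attained G)) (proj₁ (proj₂ (α-attained G))))

theorem6p6 : α (W₅ ^□ 4) ≤ 343
theorem6p6 = α-bound (W₅ ^□ 4) 343 size≤343
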